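{- Let $F$ be a symmetric Ferrers shape, $n\ge0$ an integer and $s,t$ positive integers. Let $N_{\mathrm{sym}}(F;n;\mathit{NE}=s,\mathit{SE}=t)$ be the number of symmetric $0$-$1$-fillings of $F$ with exactly $n$ ones, at most one $1$ in each row and each column, whose longest NE-chain has length $s$ and whose longest SE-chain (among those whose smallest enclosing rectangle is contained in $F$) has length $t$. Then $$N_{\mathrm{sym}}(F;n;\mathit{NE}=s,\mathit{SE}=t)=N_{\mathrm{sym}}(F;n;\mathit{NE}=t,\mathit{SE}=s).$$
   Context: A Ferrers shape (French notation) has columns $1,\dots,m$ from left to right and rows numbered from the bottom; column $j$ consists of the cells in rows $1,\dots,h_j$, $h_1\ge\dots\ge h_m\ge1$. Denote the cell in column $j$, row $i$ by $(j,i)$. $F$ is symmetric (self-conjugate) if $(j,i)\in F\iff(i,j)\in F$; a filling is symmetric if the entries of $(j,i)$ and $(i,j)$ agree for all cells. An NE-chain is a sequence of cells containing $1$, each strictly above and strictly to the right of the preceding one; an SE-chain is a sequence of cells containing $1$, each strictly below and strictly to the right of the preceding one; length = number of cells. The smallest enclosing rectangle of a chain consists of the cells whose column lies between the columns of the first and last cells and whose row lies between their rows. -}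

module Defs where

open import Data.Nat using (ℕ; zero; suc; _+_; _∸_; _≤_; _≤ᵇ_; _<ᵇ_; _≡ᵇ_; _⊔_; _⊓_)
open import Data.Bool using (Bool; true; false; _∧_; _∨_; not; if_then_else_; T)
open import Data.Product using (_×_; _,_; proj₁; proj₂)
open import Data.List using (List; []; _∷_; _++_; map; concatMap; upTo; length; foldr; filterᵇ)
open import Data.Bool.ListAction using (all; any)
open import Data.List.Relation.Unary.All using (All)
open import Data.List.Relation.Unary.Linked using (Linked)

-- A cell (j , i) : column j, row i (both 1-indexed, rows counted from the bottom).
Cell : Set
Cell = ℕ × ℕ

col row : Cell → ℕ
col = proj₁
row = proj₂

-- A Ferrers shape is given by its list of column heights h₁ ≥ h₂ ≥ … ≥ hₘ ≥ 1.
IsFerrers : List ℕ → Set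
IsFerrers h = Linked (λ a b → b ≤ a) h × All (1 ≤_) h

-- height of column j (1-indexed); 0 outside the columns 1..m
heightOf : List ℕ → ℕ → ℕ
heightOf []       _             = 0
heightOf (x ∷ xs) zero          = 0
heightOf (x ∷ xs) (suc zero)    = x
heightOf (x ∷ xs) (suc (suc k)) = heightOf xs (suc k)

inF : List ℕ → Cell → Bool
inF h (j , i) = (1 ≤ᵇ i) ∧ (i ≤ᵇ heightOf h j)

SymmetricShape : List ℕ → Set
SymmetricShape h = ∀ j i → (T (inF h (j , i)) → T (inF h (i , j))) × (T (inF h (i , j)) → T (inF h (j , i)))

cellsFrom : ℕ → List ℕ → List Cell
cellsFrom j []        = []
cellsFrom j (hj ∷ hs) = map (λ i → (j , suc i)) (upTo hj) ++ cellsFrom (suc j) hs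

cells : List ℕ → List Cell
cells h = cellsFrom 1 h

-- all sublists (= all subsets of a duplicate-free list, each exactly once)
sublists : {A : Set} → List A → List (List A)
sublists []       = [] ∷ []
sublists (x ∷ xs) = map (x ∷_) (sublists xs) ++ sublists xs

-- A 0-1-filling of F is identified with the set S ⊆ cells F of its 1-cells.

cellEq : Cell → Cell → Bool
cellEq a b = (col a ≡ᵇ col b) ∧ (row a ≡ᵇ row b)

elem : Cell → List Cell → Bool
elem a S = any (cellEq a) S

swap : Cell → Cell
swap (j , i) = (i , j)

atMostOnePerLine : List Cell → Bool
atMostOnePerLine S =
  all (λ a → all (λ b → cellEq a b ∨ (not (col a ≡ᵇ col b) ∧ not (row a ≡ᵇ row b))) S) S

symmetricFilling : List Cell → Bool
symmetricFilling S = all (λ a → elem (swap a) S) S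

seqs : ℕ → List Cell → List (List Cell)
seqs zero    S = [] ∷ []
seqs (suc k) S = concatMap (λ c → map (c ∷_) (seqs k S)) S

consec : (Cell → Cell → Bool) → List Cell → Bool
consec R []           = true
consec R (a ∷ [])     = true
consec R (a ∷ b ∷ cs) = R a b ∧ consec R (b ∷ cs)

neStep : Cell → Cell → Bool
neStep a b = (col a <ᵇ col b) ∧ (row a <ᵇ row b)

seStep : Cell → Cell → Bool
seStep a b = (col a <ᵇ col b) ∧ (row b <ᵇ row a)

range : ℕ → ℕ → List ℕ
range lo hi = map (lo +_) (upTo (suc (hi ∸ lo)))

rectIn : List ℕ → Cell → Cell → Bool
rectIn h a b =
  all (λ j → all (λ i → inF h (j , i))
                 (range (row a ⊓ row b) (row a ⊔ row b)))
      (range (col a ⊓ col b) (col a ⊔ col b))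

lastOr : Cell → List Cell → Cell
lastOr a []       = a
lastOr a (b ∷ bs) = lastOr b bs

-- smallest enclosing rectangle of a chain contained in F
rectOK : List ℕ → List Cell → Bool
rectOK h []       = true
rectOK h (a ∷ cs) = rectIn h a (lastOr a cs)

isNEchain : List Cell → Bool
isNEchain c = consec neStep c

isSEchainInF : List ℕ → List Cell → Bool
isSEchainInF h c = consec seStep c ∧ rectOK h c

hasChain : (List Cell → Bool) → ℕ → List Cell → Bool
hasChain P k S = any P (seqs k S)

-- length of the longest chain; chains consist of distinct 1-cells, so their
-- length is at most |S| and it suffices to look at lengths 0..|S|
longest : (List Cell → Bool) → List Cell → ℕ
longest P S = foldr _⊔_ 0 (map (λ k → if hasChain P k S then k else 0) (upTo (suc (length S))))

longestNE : List Cell → ℕ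
longestNE S = longest isNEchain S

longestSE : List ℕ → List Cell → ℕ
longestSE h S = longest (isSEchainInF h) S

admissible : List ℕ → ℕ → ℕ → ℕ → List Cell → Bool
admissible h n s t S =
  (length S ≡ᵇ n) ∧ atMostOnePerLine S ∧ symmetricFilling S
  ∧ (longestNE S ≡ᵇ s) ∧ (longestSE h S ≡ᵇ t)

Nsym : List ℕ → ℕ → ℕ → ℕ → ℕ
Nsym h n s t = length (filterᵇ (admissible h n s t) (sublists (cells h)))

{-# OPTIONS --safe #-}

-- Attach to every lattice point (x , y) of the shape the partition Λ of the growth diagram of the
-- filling.  In Viennot's description its r-th part is the longest NE-chain, inside the rectangle
-- south-west of (x , y), of the r-th shadow ∂^ r of the filling.  Its first part is the longest
-- NE-chain, and since a shadow step shortens the longest SE-chain by exactly one, the number of its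
-- parts is the longest SE-chain in the rectangle.  The partitions along the north-east boundary
-- determine the filling through Fomin's local rules, and any boundary sequence whose steps add or
-- remove at most one box occurs.  Conjugating them gives an involution Φ exchanging the two chain
-- lengths; it keeps the number of ones in every column, and commutes with transposition.

module Submission where

open import Defs
open import Data.Nat
open import Data.Nat.Properties
open import Data.Nat.Tactic.RingSolver using (solve-∀)
open import Data.Bool using (Bool; true; false; T; _∧_; _∨_; not; if_then_else_)
open import Data.Bool.Properties using (T-∧; T-∨; T-≡; T?)
open import Data.List using (List; []; _∷_; _++_; [_]; map; upTo; length; foldr; filterᵇ)
open import Data.List.Properties using (length-map; length-++; map-++; filter-++; upTo-∷ʳ; map-cong; ∷-injectiveʳ)
open import Data.List.Relation.Unary.All as All using (All; []; _∷_)
open import Data.List.Relation.Unary.All.Properties as AllP using (all⁺; all⁻)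
open import Data.List.Relation.Unary.Any as Any using (here; there)
open import Data.List.Relation.Unary.Any.Properties using (any⁺; any⁻)
open import Data.List.Relation.Unary.AllPairs using ([]; _∷_)
open import Data.List.Relation.Unary.Linked using (Linked; []; [-]; _∷_)
open import Data.List.Relation.Unary.Unique.Propositional using (Unique)
import Data.List.Relation.Unary.Unique.Propositional.Properties as Uniq
open import Data.List.Membership.Propositional using (_∈_; find; lose)
open import Data.List.Membership.Propositional.Properties
  using (∈-map⁺; ∈-map⁻; ∈-++⁺ˡ; ∈-++⁺ʳ; ∈-++⁻; ∈-∃++; ∈-concatMap⁺; ∈-concatMap⁻; ∈-upTo⁺; ∈-upTo⁻; ∈-filter⁺; ∈-filter⁻)
open import Data.Product using (_×_; _,_; proj₁; proj₂; ∃; ∃₂)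
open import Data.Sum using (_⊎_; inj₁; inj₂)
open import Data.Empty using (⊥; ⊥-elim)
open import Data.Unit using (⊤; tt)
open import Function using (_∘_)
open import Function.Bundles using (Equivalence)
open import Relation.Binary.Definitions using (tri<; tri≈; tri>)
open import Relation.Nullary using (¬_; Dec; yes; no)
open import Relation.Binary.PropositionalEquality hiding ([_])

-- Every rectangle inside `F` extends to one reaching from the origin to the top of a column, and an
-- NE-chain in `F` lies south-west of its last cell. Hence both statistics are visible at the
-- corners `(suc x , H x)`. Conjugation turns horizontal strips into vertical ones. It is harmless
-- on the boundary because a strip of at most one box is both, but in the interior the growth
-- diagram of `Φ S` is in general not the conjugate of that of `S` and has to be regrown backwards.
-- Instead of tracing a boundary path, the filling is extended by zeros to the quarter plane and
-- conjugate partitions are prescribed at every lattice point off `F`. Boundary and exterior then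
-- form a single base case. That the regrown diagram really is the growth diagram of `Φ S` is a
-- comparison in the forward direction, starting from empty partitions on the axes. Since
-- subtraction on `ℕ` truncates, conservation laws are written additively throughout.

Grid : Set
Grid = ℕ → ℕ → ℕ

-- Sums over initial segments

∑ : ℕ → (ℕ → ℕ) → ℕ
∑ zero    f = 0
∑ (suc n) f = ∑ n f + f n

∑-cong : ∀ n {f g : ℕ → ℕ} → (∀ i → i < n → f i ≡ g i) → ∑ n f ≡ ∑ n g
∑-cong zero    e = refl
∑-cong (suc n) e = cong₂ _+_ (∑-cong n λ i i<n → e i (m<n⇒m<1+n i<n)) (e n (n<1+n n))

∑-mono-≤ : ∀ n {f g : ℕ → ℕ} → (∀ i → i < n → f i ≤ g i) → ∑ n f ≤ ∑ n g
∑-mono-≤ zero    e = z≤n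
∑-mono-≤ (suc n) e = +-mono-≤ (∑-mono-≤ n λ i i<n → e i (m<n⇒m<1+n i<n)) (e n (n<1+n n))

∑-extend : ∀ f {m n} → m ≤ n → ∑ m f ≤ ∑ n f
∑-extend f {m} {n} m≤n = go (≤⇒≤′ m≤n)
  where
  go : ∀ {n} → m ≤′ n → ∑ m f ≤ ∑ n f
  go ≤′-refl     = ≤-refl
  go (≤′-step p) = ≤-trans (go p) (m≤m+n _ _)

∑-member : ∀ f {i n} → i < n → ∑ i f + f i ≤ ∑ n f
∑-member f i<n = ∑-extend f i<n

term≤∑ : ∀ f {i n} → i < n → f i ≤ ∑ n f
term≤∑ f i<n = ≤-trans (m≤n+m _ _) (∑-member f i<n)

∑-witness : ∀ f {m n} → m ≤ n → ∑ m f < ∑ n f → ∃ λ i → m ≤ i × i < n × 0 < f i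
∑-witness f {m} {n} m≤n lt = go (≤⇒≤′ m≤n) lt
  where
  go : ∀ {n} → m ≤′ n → ∑ m f < ∑ n f → ∃ λ i → m ≤ i × i < n × 0 < f i
  go ≤′-refl lt = ⊥-elim (<-irrefl refl lt)
  go {suc n} (≤′-step p) lt with f n in eq
  ... | suc k = n , ≤′⇒≤ p , n<1+n n , subst (0 <_) (sym eq) z<s
  ... | zero with go p (subst (_ <_) (+-identityʳ _) lt)
  ... | i , m≤i , i<n , pos = i , m≤i , m<n⇒m<1+n i<n , pos

∑-positive : ∀ f {n} → 0 < ∑ n f → ∃ λ i → i < n × 0 < f i
∑-positive f pos with ∑-witness f z≤n pos
... | i , _ , i<n , p = i , i<n , p

∑-+ : ∀ n f g → ∑ n (λ i → f i + g i) ≡ ∑ n f + ∑ n g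
∑-+ zero    f g = refl
∑-+ (suc n) f g rewrite ∑-+ n f g = rearrange (∑ n f) (∑ n g) (f n) (g n)
  where
  rearrange : ∀ a b c d → (a + b) + (c + d) ≡ (a + c) + (b + d)
  rearrange = solve-∀

∑-zero : ∀ n → ∑ n (λ _ → 0) ≡ 0
∑-zero zero    = refl
∑-zero (suc n) = trans (+-identityʳ _) (∑-zero n)

∑-swap : ∀ m n (f : Grid) → ∑ m (λ i → ∑ n (f i)) ≡ ∑ n (λ j → ∑ m (λ i → f i j))
∑-swap zero    n f = sym (∑-zero n)
∑-swap (suc m) n f rewrite ∑-swap m n f = sym (∑-+ n (λ j → ∑ m (λ i → f i j)) (f m))

-- Last passage times and shadow points

-- Last passage time over the cells left of `x` and below `y`; the lattice point `(x , y)` is the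
-- south-west corner of the cell `(x , y)`. Paths are weakly increasing; with at most one 1 per line
-- they count strict NE-chains.
L : Grid → Grid
L B zero    y       = 0
L B (suc x) zero    = 0
L B (suc x) (suc y) = (L B x (suc y) ⊔ L B (suc x) y) + B x y

-- The corners of Viennot's shadow lines of B.
∂ : Grid → Grid
∂ B x y = (L B x (suc y) ⊓ L B (suc x) y) ∸ L B x y

rowSum colSum : Grid → Grid
rowSum B x y = ∑ x (λ j → B j y)
colSum B x y = ∑ y (B x)

L-zeroʳ : ∀ B x → L B x 0 ≡ 0
L-zeroʳ B zero    = refl
L-zeroʳ B (suc x) = refl

L-transpose : ∀ {B C} → (∀ x y → B x y ≡ C y x) → ∀ x y → L B x y ≡ L C y x
L-transpose {B} {C} e zero    y       = sym (L-zeroʳ C y)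
L-transpose {B} {C} e (suc x) zero    = refl
L-transpose {B} {C} e (suc x) (suc y) =
  cong₂ _+_ (trans (cong₂ _⊔_ (L-transpose e x (suc y)) (L-transpose e (suc x) y))
                   (⊔-comm (L C (suc y) x) (L C y (suc x))))
            (e x y)

∂-transpose : ∀ {B C} → (∀ x y → B x y ≡ C y x) → ∀ x y → ∂ B x y ≡ ∂ C y x
∂-transpose {B} {C} e x y =
  cong₂ _∸_ (trans (cong₂ _⊓_ (L-transpose e x (suc y)) (L-transpose e (suc x) y))
                   (⊓-comm (L C (suc y) x) (L C y (suc x))))
            (L-transpose e x y)

L-cong : ∀ {B C} → (∀ x y → B x y ≡ C x y) → ∀ x y → L B x y ≡ L C x y
L-cong {B} {C} e x y = trans (L-transpose {B} {λ u v → C v u} e x y) (L-transpose {λ u v → C v u} {C} (λ _ _ → refl) y x)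

∂-cong : ∀ {B C} → (∀ x y → B x y ≡ C x y) → ∀ x y → ∂ B x y ≡ ∂ C x y
∂-cong e x y = cong₂ _∸_ (cong₂ _⊓_ (L-cong e x (suc y)) (L-cong e (suc x) y)) (L-cong e x y)

L-stepˣ : ∀ B x y → L B x y ≤ L B (suc x) y
L-stepˣ B x zero    = ≤-reflexive (L-zeroʳ B x)
L-stepˣ B x (suc y) = ≤-trans (m≤m⊔n _ _) (m≤m+n _ _)

L-stepʸ : ∀ B x y → L B x y ≤ L B x (suc y)
L-stepʸ B zero    y = z≤n
L-stepʸ B (suc x) y = ≤-trans (m≤n⊔m (L B x (suc y)) _) (m≤m+n _ _)

L-mono : ∀ B {x x′ y y′} → x ≤ x′ → y ≤ y′ → L B x y ≤ L B x′ y′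
L-mono B {x} {x′} {y} {y′} x≤x′ y≤y′ = ≤-trans (goˣ (≤⇒≤′ x≤x′)) (goʸ (≤⇒≤′ y≤y′))
  where
  goˣ : ∀ {x′} → x ≤′ x′ → L B x y ≤ L B x′ y
  goˣ ≤′-refl     = ≤-refl
  goˣ (≤′-step p) = ≤-trans (goˣ p) (L-stepˣ B _ y)
  goʸ : ∀ {y′} → y ≤′ y′ → L B x′ y ≤ L B x′ y′
  goʸ ≤′-refl     = ≤-refl
  goʸ (≤′-step p) = ≤-trans (goʸ p) (L-stepʸ B x′ _)

∂-eq : ∀ B x y → L B x y + ∂ B x y ≡ L B x (suc y) ⊓ L B (suc x) y
∂-eq B x y = m+[n∸m]≡n (⊓-glb (L-stepʸ B x y) (L-stepˣ B x y))

⊔+⊓ : ∀ m n → (m ⊔ n) + (m ⊓ n) ≡ m + n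
⊔+⊓ m n with ≤-total m n
... | inj₁ m≤n rewrite m≤n⇒m⊔n≡n m≤n | m≤n⇒m⊓n≡m m≤n = +-comm n m
... | inj₂ n≤m rewrite m≥n⇒m⊔n≡m n≤m | m≥n⇒m⊓n≡n n≤m = refl

-- Conservation along row `y`: each 1 starts a horizontal ray, each corner in `∂ B` ends one, and
-- the jump of `L B` from `(x , y)` to `(x , suc y)` counts the rays still running.
row-L : ∀ B x y → L B x (suc y) + rowSum (∂ B) x y ≡ L B x y + rowSum B x y
row-L B zero    y = refl
row-L B (suc x) y = +-cancelˡ-≡ ρ _ _ (begin
  ρ + (((μ ⊔ ν) + b) + (r′ + d))  ≡⟨ e₁ ρ (μ ⊔ ν) b r′ d ⟩
  ((μ ⊔ ν) + (ρ + d)) + (b + r′)  ≡⟨ cong (λ z → ((μ ⊔ ν) + z) + (b + r′)) (∂-eq B x y) ⟩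
  ((μ ⊔ ν) + (μ ⊓ ν)) + (b + r′)  ≡⟨ cong (_+ (b + r′)) (⊔+⊓ μ ν) ⟩
  (μ + ν) + (b + r′)              ≡⟨ e₂ μ ν b r′ ⟩
  (μ + r′) + (ν + b)              ≡⟨ cong (_+ (ν + b)) (row-L B x y) ⟩
  (ρ + r) + (ν + b)               ≡⟨ e₃ ρ r ν b ⟩
  ρ + (ν + (r + b))               ∎)
  where
  open ≡-Reasoning
  μ = L B x (suc y)
  ν = L B (suc x) y
  ρ = L B x y
  b = B x y
  d = ∂ B x y
  r = rowSum B x y
  r′ = rowSum (∂ B) x y
  e₁ : ∀ p m b r d → p + ((m + b) + (r + d)) ≡ (m + (p + d)) + (b + r)
  e₁ = solve-∀
  e₂ : ∀ m n b r → (m + n) + (b + r) ≡ (m + r) + (n + b)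
  e₂ = solve-∀
  e₃ : ∀ p r n b → (p + r) + (n + b) ≡ p + (n + (r + b))
  e₃ = solve-∀

col-L : ∀ B x y → L B (suc x) y + colSum (∂ B) x y ≡ L B x y + colSum B x y
col-L B x y = begin
  L B (suc x) y + colSum (∂ B) x y          ≡⟨ cong₂ _+_ (L-transpose t (suc x) y) (∑-cong y λ i _ → ∂-transpose t x i) ⟩
  L Bᵗ y (suc x) + rowSum (∂ Bᵗ) y x        ≡⟨ row-L Bᵗ y x ⟩
  L Bᵗ y x + rowSum Bᵗ y x                  ≡⟨ cong (_+ colSum B x y) (sym (L-transpose t x y)) ⟩
  L B x y + colSum B x y                    ∎
  where
  open ≡-Reasoning
  Bᵗ : Grid
  Bᵗ x y = B y x
  t : ∀ x y → B x y ≡ Bᵗ y x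
  t _ _ = refl

private
  squeeze : ∀ {l l′ r r′} → l ≤ l′ → l′ + r′ ≡ l + r → r′ ≤ r
  squeeze {l} {l′} {r} {r′} l≤l′ e = +-cancelˡ-≤ l′ r′ r (≤-trans (≤-reflexive e) (+-monoˡ-≤ r l≤l′))

row-∂≤row : ∀ B x y → rowSum (∂ B) x y ≤ rowSum B x y
row-∂≤row B x y = squeeze (L-stepʸ B x y) (row-L B x y)

col-∂≤col : ∀ B x y → colSum (∂ B) x y ≤ colSum B x y
col-∂≤col B x y = squeeze (L-stepˣ B x y) (col-L B x y)

record PP (B : Grid) : Set where
  field
    row≤1 : ∀ x y → rowSum B x y ≤ 1
    col≤1 : ∀ x y → colSum B x y ≤ 1
open PP

PP-∂ : ∀ {B} → PP B → PP (∂ B)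
PP-∂ {B} pp = record
  { row≤1 = λ x y → ≤-trans (row-∂≤row B x y) (row≤1 pp x y)
  ; col≤1 = λ x y → ≤-trans (col-∂≤col B x y) (col≤1 pp x y)
  }

-- Both bounds follow from `L-∂-diag`, whose minimum is below either argument. There the recursion
-- adds `∂ B x y`, exactly the gap between `L B x y` and that minimum. For the partitions `Λ` this
-- becomes the horizontal strip condition.
L-∂-interlace : ∀ B x y → L (∂ B) (suc x) y ≤ L B x y × L (∂ B) x (suc y) ≤ L B x y
L-∂-diag : ∀ B x y → L (∂ B) (suc x) (suc y) ≤ L B x (suc y) ⊓ L B (suc x) y

L-∂-interlace B x y = goˣ x y , goʸ x y
  where
  goˣ : ∀ x y → L (∂ B) (suc x) y ≤ L B x y
  goˣ x zero    = z≤n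
  goˣ x (suc y) = ≤-trans (L-∂-diag B x y) (m⊓n≤m _ _)
  goʸ : ∀ x y → L (∂ B) x (suc y) ≤ L B x y
  goʸ zero    y = z≤n
  goʸ (suc x) y = ≤-trans (L-∂-diag B x y) (m⊓n≤n _ _)
L-∂-diag B x y = begin
  (L (∂ B) x (suc y) ⊔ L (∂ B) (suc x) y) + ∂ B x y
    ≤⟨ +-monoˡ-≤ (∂ B x y) (⊔-lub (proj₂ (L-∂-interlace B x y)) (proj₁ (L-∂-interlace B x y))) ⟩
  L B x y + ∂ B x y
    ≡⟨ ∂-eq B x y ⟩
  L B x (suc y) ⊓ L B (suc x) y ∎
  where open ≤-Reasoning

-- Chains

private
  pp-first : ∀ f {i n} → i < n → ∑ n f ≤ 1 → 0 < f i → ∑ i f ≡ 0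
  pp-first f {i} i<n le pos = n<1⇒n≡0 (≤-trans (≤-trans (≤-reflexive (+-comm 1 _)) (+-monoʳ-≤ (∑ i f) pos))
                                             (≤-trans (∑-member f i<n) le))

row-vanish : ∀ {B} → PP B → ∀ {x u y} → x ≤ u → 0 < B u y → rowSum B x y ≡ 0
row-vanish {B} pp {x} {u} {y} x≤u pos =
  n≤0⇒n≡0 (≤-trans (∑-extend f x≤u) (≤-reflexive (pp-first f (n<1+n u) (row≤1 pp (suc u) y) pos)))
  where f = λ j → B j y

col-vanish : ∀ {B} → PP B → ∀ {x y v} → y ≤ v → 0 < B x v → colSum B x y ≡ 0
col-vanish {B} pp {x} {y} {v} y≤v pos =
  n≤0⇒n≡0 (≤-trans (∑-extend (B x) y≤v) (≤-reflexive (pp-first (B x) (n<1+n v) (col≤1 pp x (suc v)) pos)))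

row-unique : ∀ {B} → PP B → ∀ {x x′ y} → 0 < B x y → 0 < B x′ y → x ≡ x′
row-unique {B} pp {x} {x′} {y} p p′ with <-cmp x x′
... | tri< x<x′ _ _ = ⊥-elim (<⇒≱ (≤-trans p (term≤∑ (λ j → B j y) x<x′)) (≤-reflexive (row-vanish pp ≤-refl p′)))
... | tri≈ _ e _    = e
... | tri> _ _ x′<x = ⊥-elim (<⇒≱ (≤-trans p′ (term≤∑ (λ j → B j y) x′<x)) (≤-reflexive (row-vanish pp ≤-refl p)))

col-unique : ∀ {B} → PP B → ∀ {x y y′} → 0 < B x y → 0 < B x y′ → y ≡ y′
col-unique {B} pp {x} {y} {y′} p p′ with <-cmp y y′
... | tri< y<y′ _ _ = ⊥-elim (<⇒≱ (≤-trans p (term≤∑ (B x) y<y′)) (≤-reflexive (col-vanish pp {x} ≤-refl p′)))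
... | tri≈ _ e _    = e
... | tri> _ _ y′<y = ⊥-elim (<⇒≱ (≤-trans p′ (term≤∑ (B x) y′<y)) (≤-reflexive (col-vanish pp {x} ≤-refl p)))

private
  -- Readings of the balances `row-L` and `col-L`: `l` and `l′` are the passage times on the two
  -- sides of an edge, `r` the rays started, `r′` the rays ended.
  rise : ∀ {l l′ r r′} → l′ + r′ ≡ l + r → r′ ≡ 0 → 0 < r → l < l′
  rise {l} {l′} {r} e refl pos =
    ≤-trans (≤-reflexive (+-comm 1 l)) (≤-trans (+-monoʳ-≤ l pos) (≤-reflexive (trans (sym e) (+-identityʳ l′))))

  flat : ∀ {l l′ r r′} → l ≤ l′ → l′ + r′ ≡ l + r → r ≡ 0 → l′ ≡ l
  flat {l} {l′} {.0} {r′} l≤l′ e refl =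
    ≤-antisym (≤-trans (m≤m+n l′ r′) (≤-reflexive (trans e (+-identityʳ l)))) l≤l′

  risen : ∀ {l l′ r r′} → l′ + r′ ≡ l + r → l < l′ → 0 < r
  risen {l} {l′} {zero} {r′} e lt = ⊥-elim (<⇒≱ lt (≤-trans (m≤m+n l′ r′) (≤-reflexive (trans e (+-identityʳ l)))))
  risen {r = suc r} e lt = z<s

L-rightOf : ∀ {B} → PP B → ∀ {x u y} → x ≤ u → 0 < B u y → L B x (suc y) ≡ L B x y
L-rightOf {B} pp {x} {u} {y} x≤u pos = flat (L-stepʸ B x y) (row-L B x y) (row-vanish pp x≤u pos)

L-above : ∀ {B} → PP B → ∀ {x y v} → y ≤ v → 0 < B x v → L B (suc x) y ≡ L B x y
L-above {B} pp {x} {y} {v} y≤v pos = flat (L-stepˣ B x y) (col-L B x y) (col-vanish pp y≤v pos)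

∂-pos : ∀ B x y → L B x y < L B x (suc y) → L B x y < L B (suc x) y → 0 < ∂ B x y
∂-pos B x y p q = m<n⇒0<n∸m (⊓-glb p q)

∂-pos⁻¹ : ∀ B x y → 0 < ∂ B x y → L B x y < L B x (suc y) × L B x y < L B (suc x) y
∂-pos⁻¹ B x y pos = ≤-trans lt (m⊓n≤m _ _) , ≤-trans lt (m⊓n≤n _ _)
  where
  lt : L B x y < L B x (suc y) ⊓ L B (suc x) y
  lt = ≤-trans (≤-reflexive (+-comm 1 _)) (≤-trans (+-monoʳ-≤ (L B x y) pos) (≤-reflexive (∂-eq B x y)))

-- The horizontal ray leaving (x , y) and the vertical ray leaving (x′ , y′)
-- would meet at (x′ , y) unless one of them is stopped before.
∂-between : ∀ {B} → PP B → ∀ {x y x′ y′} → x < x′ → y′ < y → 0 < B x y → 0 < B x′ y′ →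
            ∃₂ λ u v → x < u × u ≤ x′ × y′ < v × v ≤ y × 0 < ∂ B u v
∂-between {B} pp {x} {y} {x′} {y′} x<x′ y′<y p p′ with rowSum (∂ B) x′ y in er | colSum (∂ B) x′ y in ec
... | suc _ | _ =
  let u , x<u , u<x′ , q = ∑-witness (λ j → ∂ B j y) x<x′
                             (subst₂ _<_ (sym zero-here) (sym er) z<s)
  in u , y , x<u , <⇒≤ u<x′ , y′<y , ≤-refl , q
  where
  -- The 1 at `x` is the first in its row, so no ray of row `y` ends in a column up to `x`; the
  -- stopping corner lies strictly to the right.
  zero-here : rowSum (∂ B) (suc x) y ≡ 0
  zero-here = +-cancelˡ-≡ (L B (suc x) (suc y)) _ _ (begin
    L B (suc x) (suc y) + rowSum (∂ B) (suc x) y  ≡⟨ row-L B (suc x) y ⟩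
    L B (suc x) y + (rowSum B x y + B x y)        ≡⟨ cong (λ z → L B (suc x) y + (z + B x y)) (row-vanish pp ≤-refl p) ⟩
    L B (suc x) y + B x y                      ≡⟨ cong (_+ B x y) (sym (m≤n⇒m⊔n≡n (≤-trans (≤-reflexive (L-rightOf pp ≤-refl p)) (L-stepˣ B x y)))) ⟩
    L B (suc x) (suc y)                        ≡⟨ sym (+-identityʳ _) ⟩
    L B (suc x) (suc y) + 0                    ∎)
    where open ≡-Reasoning
... | zero | suc _ =
  let v , y′<v , v<y , q = ∑-witness (∂ B x′) y′<y
                             (subst₂ _<_ (sym zero-here) (sym ec) z<s)
  in x′ , v , x<x′ , ≤-refl , y′<v , <⇒≤ v<y , q
  where
  zero-here : colSum (∂ B) x′ (suc y′) ≡ 0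
  zero-here = +-cancelˡ-≡ (L B (suc x′) (suc y′)) _ _ (begin
    L B (suc x′) (suc y′) + colSum (∂ B) x′ (suc y′)   ≡⟨ col-L B x′ (suc y′) ⟩
    L B x′ (suc y′) + (colSum B x′ y′ + B x′ y′)       ≡⟨ cong (λ z → L B x′ (suc y′) + (z + B x′ y′)) (col-vanish pp ≤-refl p′) ⟩
    L B x′ (suc y′) + B x′ y′                       ≡⟨ cong (_+ B x′ y′) (sym (m≥n⇒m⊔n≡m (≤-trans (≤-reflexive (L-above pp ≤-refl p′)) (L-stepʸ B x′ y′)))) ⟩
    L B (suc x′) (suc y′)                           ≡⟨ sym (+-identityʳ _) ⟩
    L B (suc x′) (suc y′) + 0                       ∎)
    where open ≡-Reasoning
-- Neither ray is stopped earlier, so they cross at `(x′ , y)`.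
... | zero | zero = x′ , y , x<x′ , ≤-refl , y′<y , ≤-refl ,
  ∂-pos B x′ y (rise (row-L B x′ y) er (≤-trans p (term≤∑ (λ j → B j y) x<x′)))
               (rise (col-L B x′ y) ec (≤-trans p′ (term≤∑ (B x′) y′<y)))

∂-sources : ∀ B x y → 0 < ∂ B x y → (∃ λ a → a < x × 0 < B a y) × (∃ λ b → b < y × 0 < B x b)
∂-sources B x y pos =
  let p , q = ∂-pos⁻¹ B x y pos in
  ∑-positive (λ j → B j y) (risen (row-L B x y) p) , ∑-positive (B x) (risen (col-L B x y) q)

-- The two candidates are the 1 below the first corner and the 1 left of the second. If both fall
-- outside the region, `(x , y′)` becomes a second corner in row `y′`.
between-∂ : ∀ {B} → PP B → ∀ {x y x′ y′} → x < x′ → y′ < y → 0 < ∂ B x y → 0 < ∂ B x′ y′ →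
            ∃₂ λ u v → x ≤ u × u < x′ × y′ ≤ v × v < y × 0 < B u v
between-∂ {B} pp {x} {y} {x′} {y′} x<x′ y′<y p p′
  with ∂-sources B x y p | ∂-sources B x′ y′ p′
... | _ , b , b<y , q | (a , a<x′ , q′) , _ with y′ ≤? b | x ≤? a
... | yes y′≤b | _       = x , b , ≤-refl , x<x′ , y′≤b , b<y , q
... | no  _    | yes x≤a = a , y′ , x≤a , a<x′ , ≤-refl , y′<y , q′
... | no  y′≰b | no  x≰a = ⊥-elim (<⇒≱ crossing (≤-reflexive (m+n≡0⇒n≡0 (rowSum (∂ B) x y′)
                                                              (row-vanish (PP-∂ pp) x<x′ p′))))
  where
  -- otherwise the two rays through (x , y′) would already have met there
  crossing : 0 < ∂ B x y′
  crossing = ∂-pos B x y′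
    (rise (row-L B x y′) (row-vanish (PP-∂ pp) (<⇒≤ x<x′) p′) (≤-trans q′ (term≤∑ (λ j → B j y′) (≰⇒> x≰a))))
    (rise (col-L B x y′) (col-vanish (PP-∂ pp) {x} (<⇒≤ y′<y) p) (≤-trans q (term≤∑ (B x) (≰⇒> y′≰b))))

-- SE B X x y k: an SE-chain of k positive cells of B with columns in [x , X) and rows below y.
data SE (B : Grid) (X : ℕ) : ℕ → ℕ → ℕ → Set where
  nil  : ∀ {x y} → x ≤ X → SE B X x y 0
  cons : ∀ {x y k} u v → x ≤ u → v < y → 0 < B u v → SE B X (suc u) v k → SE B X x y (suc k)

-- NE B X Y x y k: an NE-chain of k positive cells of B in [x , X) × [y , Y).
data NE (B : Grid) (X Y : ℕ) : ℕ → ℕ → ℕ → Set where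
  nil  : ∀ {x y} → x ≤ X → y ≤ Y → NE B X Y x y 0
  cons : ∀ {x y k} u v → x ≤ u → y ≤ v → 0 < B u v → NE B X Y (suc u) (suc v) k → NE B X Y x y (suc k)

SE-weaken : ∀ {B X x x′ y y′ k} → x′ ≤ x → y ≤ y′ → SE B X x y k → SE B X x′ y′ k
SE-weaken p q (nil r)            = nil (≤-trans p r)
SE-weaken p q (cons u v r s t c) = cons u v (≤-trans p r) (≤-trans s q) t c

SE-bound : ∀ {B X x y k} → SE B X x y k → x ≤ X
SE-bound (nil r)            = r
SE-bound (cons u v r s t c) = ≤-trans r (≤-trans (n≤1+n u) (SE-bound c))

SE-map : ∀ {B C X X′} → (∀ u v → 0 < B u v → 0 < C u v) → X ≤ X′ → ∀ {x y k} → SE B X x y k → SE C X′ x y k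
SE-map f le (nil r)            = nil (≤-trans r le)
SE-map f le (cons u v r s t c) = cons u v r s (f u v t) (SE-map f le c)

-- One corner from `∂-between` for each pair of consecutive 1s: its half-open bounds keep successive
-- corners strictly south-east of each other.
SE-shrink : ∀ {B X} → PP B → ∀ {u v k} → 0 < B u v → SE B X (suc u) v k → SE (∂ B) X (suc u) (suc v) k
SE-shrink pp p (nil r) = nil r
SE-shrink pp p (cons u′ v′ u<u′ v′<v p′ c) =
  let a , b , u<a , a≤u′ , v′<b , b≤v , q = ∂-between pp u<u′ v′<v p p′
  in cons a b u<a (s≤s b≤v) q (SE-weaken (s≤s a≤u′) v′<b (SE-shrink pp p′ c))

-- The 1s between consecutive corners and one below the last corner are as many as the corners. A
-- further 1, left of the first corner, is added in `L⇒SE`, so passing to `∂` costs exactly one.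
SE-grow : ∀ {B X} → PP B → ∀ {u v k} → 0 < ∂ B u v → SE (∂ B) X (suc u) v k → SE B X u v (suc k)
SE-grow {B} pp {u} {v} p (nil r) =
  let _ , b , b<v , q = ∂-sources B u v p
  in cons u b ≤-refl b<v q (nil r)
SE-grow pp p (cons u′ v′ u<u′ v′<v p′ c) =
  let a , b , u≤a , a<u′ , v′≤b , b<v , q = between-∂ pp u<u′ v′<v p p′
  in cons a b u≤a b<v q (SE-weaken a<u′ v′≤b (SE-grow pp p′ c))

-- Iterated shadows and chain lengths

∂^ : ℕ → Grid → Grid
∂^ zero    B = B
∂^ (suc k) B = ∂^ k (∂ B)

-- Chain arguments peel off the innermost `∂`, the local rules the outermost.
∂^-suc : ∀ k B → ∂^ (suc k) B ≡ ∂ (∂^ k B)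
∂^-suc zero    B = refl
∂^-suc (suc k) B = ∂^-suc k (∂ B)

L-positive : ∀ B x y → 0 < L B x y → ∃₂ λ u v → u < x × v < y × 0 < B u v
L-positive B (suc x) (suc y) pos with B x y in eq
... | suc _ = x , y , n<1+n x , n<1+n y , subst (0 <_) (sym eq) z<s
... | zero with L B x (suc y) in e₁
...   | suc _ = let u , v , p , q , r = L-positive B x (suc y) (subst (0 <_) (sym e₁) z<s)
                in u , v , m<n⇒m<1+n p , q , r
...   | zero  = let u , v , p , q , r = L-positive B (suc x) y (subst (0 <_) (+-identityʳ _) pos)
                in u , v , p , m<n⇒m<1+n q , r

L-point : ∀ B x y → 0 < B x y → L B x y < L B (suc x) (suc y)
L-point B x y pos = ≤-trans (≤-reflexive (+-comm 1 _))
  (+-mono-≤ (≤-trans (L-stepʸ B x y) (m≤m⊔n _ _)) pos)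

L⇒SE : ∀ k {B} → PP B → ∀ X y → 0 < L (∂^ k B) X y → SE B X 0 y (suc k)
L⇒SE zero {B} pp X y pos =
  let u , v , u<X , v<y , p = L-positive B X y pos in cons u v z≤n v<y p (nil u<X)
L⇒SE (suc k) pp X y pos with L⇒SE k (PP-∂ pp) X y pos
... | cons u v _ v<y p c =
  let (a , a<u , q) , _ = ∂-sources _ u v p
  in cons a v z≤n v<y q (SE-weaken a<u ≤-refl (SE-grow pp p c))

SE⇒L : ∀ k {B} → PP B → ∀ {X x y} → SE B X x y (suc k) → 0 < L (∂^ k B) X y
SE⇒L zero {B} pp (cons u v _ v<y p (nil u<X)) =
  ≤-trans (≤-trans (s≤s z≤n) (L-point B u v p)) (L-mono B u<X v<y)
SE⇒L (suc k) pp (cons u v _ v<y p c) = SE⇒L k (PP-∂ pp) (SE-weaken ≤-refl v<y (SE-shrink pp p c))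

NE-weaken : ∀ {B X Y x x′ y y′ k} → x′ ≤ x → y′ ≤ y → NE B X Y x y k → NE B X Y x′ y′ k
NE-weaken p q (nil r s)          = nil (≤-trans p r) (≤-trans q s)
NE-weaken p q (cons u v r s t c) = cons u v (≤-trans p r) (≤-trans q s) t c

NE-map : ∀ {B C X Y Y′} → (∀ u v → 0 < B u v → 0 < C u v) → Y ≤ Y′ → ∀ {x y k} → NE B X Y x y k → NE C X Y′ x y k
NE-map f le (nil r s)          = nil r (≤-trans s le)
NE-map f le (cons u v r s t c) = cons u v r s (f u v t) (NE-map f le c)

NE⇒L : ∀ {B X Y x y k} → NE B X Y x y k → L B x y + k ≤ L B X Y
NE⇒L {B} (nil p q) = ≤-trans (≤-reflexive (+-identityʳ _)) (L-mono B p q)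
NE⇒L {B} {X} {Y} {x} {y} {suc k} (cons u v p q pos c) = begin
  L B x y + suc k                ≡⟨ +-suc _ k ⟩
  suc (L B x y) + k              ≤⟨ +-monoˡ-≤ k (≤-trans (s≤s (L-mono B p q)) (L-point B u v pos)) ⟩
  L B (suc u) (suc v) + k        ≤⟨ NE⇒L c ⟩
  L B X Y                        ∎
  where open ≤-Reasoning

-- Backtracking along the recursion of `L`; the accumulated chain of length `j` lies north-east of
-- the current point.
L⇒NE : ∀ {B} → PP B → ∀ {X Y} x y k {j} → k ≤ L B x y → NE B X Y x y j → NE B X Y 0 0 (k + j)
L⇒NE pp zero    y       zero le c = NE-weaken z≤n z≤n c
L⇒NE pp (suc x) zero    zero le c = NE-weaken z≤n z≤n c
L⇒NE pp (suc x) (suc y) zero le c = NE-weaken z≤n z≤n c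
L⇒NE {B} pp (suc x) (suc y) (suc k) {j} le c with B x y in eq
... | zero with ≤-total (L B x (suc y)) (L B (suc x) y)
...   | inj₁ p = L⇒NE pp (suc x) y (suc k)
                   (subst (suc k ≤_) (trans (+-identityʳ _) (m≤n⇒m⊔n≡n p)) le) (NE-weaken ≤-refl (n≤1+n y) c)
...   | inj₂ p = L⇒NE pp x (suc y) (suc k)
                   (subst (suc k ≤_) (trans (+-identityʳ _) (m≥n⇒m⊔n≡m p)) le) (NE-weaken (n≤1+n x) ≤-refl c)
L⇒NE {B} pp {X} {Y} (suc x) (suc y) (suc k) {j} le c | suc b =
  subst (NE B X Y 0 0) (+-suc k j) (L⇒NE pp x y k k≤ (cons x y ≤-refl ≤-refl pos c))
  where
  pos : 0 < B x y
  pos = subst (0 <_) (sym eq) z<s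
  B≤1 : suc b ≤ 1
  B≤1 = subst (_≤ 1) eq (≤-trans (m≤n+m _ _) (col≤1 pp x (suc y)))
  -- No other 1 precedes this one in its row or column, so neither neighbour improves on `(x , y)`
  -- and the search continues strictly south-west.
  ⊔≡ : L B x (suc y) ⊔ L B (suc x) y ≡ L B x y
  ⊔≡ = trans (cong₂ _⊔_ (L-rightOf pp ≤-refl pos) (L-above pp ≤-refl pos)) (⊔-idem _)
  k≤ : k ≤ L B x y
  k≤ = s≤s⁻¹ (≤-trans le (≤-trans (+-mono-≤ (≤-reflexive ⊔≡) B≤1) (≤-reflexive (+-comm _ 1))))

-- Conjugation of partitions

-- The Iverson bracket of `c < n`. The recursion makes `ind (suc c) (suc n)` reduce to `ind c n`,
-- which `conj-Edge` exploits.
ind : ℕ → ℕ → ℕ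
ind c       zero    = 0
ind zero    (suc n) = 1
ind (suc c) (suc n) = ind c n

ind≤1 : ∀ c n → ind c n ≤ 1
ind≤1 c       zero    = z≤n
ind≤1 zero    (suc n) = ≤-refl
ind≤1 (suc c) (suc n) = ind≤1 c n

ind-< : ∀ {c n} → c < n → ind c n ≡ 1
ind-< {zero}  (s≤s p) = refl
ind-< {suc c} (s≤s p) = ind-< p

ind-≥ : ∀ {c n} → n ≤ c → ind c n ≡ 0
ind-≥ z≤n     = refl
ind-≥ (s≤s p) = ind-≥ p

ind-mono : ∀ c {m n} → m ≤ n → ind c m ≤ ind c n
ind-mono c       z≤n     = z≤n
ind-mono zero    (s≤s p) = ≤-refl
ind-mono (suc c) (s≤s p) = ind-mono c p

∑-ind : ∀ n a → ∑ n (λ c → ind c a) ≡ n ⊓ a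
∑-ind zero    a = refl
∑-ind (suc n) a rewrite ∑-ind n a with n <? a
... | yes n<a rewrite ind-< n<a | m≤n⇒m⊓n≡m n<a | m≤n⇒m⊓n≡m (<⇒≤ n<a) = +-comm n 1
... | no  n≮a rewrite ind-≥ (≮⇒≥ n≮a) | m≥n⇒m⊓n≡n (≮⇒≥ n≮a) | m≥n⇒m⊓n≡n (m≤n⇒m≤1+n (≮⇒≥ n≮a)) = +-identityʳ a

∑-ones : ∀ n {g} → (∀ s → s < n → g s ≡ 1) → ∑ n g ≡ n
∑-ones zero    e = refl
∑-ones (suc n) e = trans (cong₂ _+_ (∑-ones n λ s s<n → e s (m<n⇒m<1+n s<n)) (e n (n<1+n n))) (+-comm n 1)

∑-support : ∀ n r {g} → (∀ s → g s ≤ 1) → (∀ s → r ≤ s → g s ≡ 0) → ∑ n g ≤ r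
∑-support zero    r     _ _ = z≤n
∑-support (suc n) r {g} b z with r ≤? n
... | yes r≤n = subst (_≤ r) (sym (trans (cong (∑ n g +_) (z n r≤n)) (+-identityʳ _))) (∑-support n r b z)
... | no  r≰n = ≤-trans (+-mono-≤ (count n) (b n)) (≤-trans (≤-reflexive (+-comm n 1)) (≰⇒> r≰n))
  where
  count : ∀ n → ∑ n g ≤ n
  count zero    = z≤n
  count (suc n) = ≤-trans (+-mono-≤ (count n) (b n)) (≤-reflexive (+-comm n 1))

-- No single term grows by more than the total. Applied to partitions: a step of at most one box
-- lengthens each row by at most one.
∑-differ : ∀ n {f g} → (∀ r → f r ≤ g r) → ∀ {r} → r < n → g r + ∑ n f ≤ f r + ∑ n g
∑-differ (suc n) {f} {g} le {r} r<1+n with m≤n⇒m<n∨m≡n (s≤s⁻¹ r<1+n)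
... | inj₂ refl = ≤-trans (≤-reflexive (swap₁ (g r) (∑ n f) (f r)))
                          (+-monoʳ-≤ (f r) (+-monoˡ-≤ (g r) (∑-mono-≤ n λ i _ → le i)))
  where
  swap₁ : ∀ a b c → a + (b + c) ≡ c + (b + a)
  swap₁ = solve-∀
... | inj₁ r<n  = subst₂ _≤_ (+-assoc (g r) _ _) (+-assoc (f r) _ _) (+-mono-≤ (∑-differ n le r<n) (le n))

-- Turns the equivalence of `c < f r` and `r < conj f c` into the involutivity of `conj`.
≡-from-< : ∀ {a b} → (∀ c → c < a → c < b) → (∀ c → c < b → c < a) → a ≡ b
≡-from-< {a} {b} p q = ≤-antisym (bound p) (bound q)
  where
  bound : ∀ {a b} → (∀ c → c < a → c < b) → a ≤ b
  bound {zero}  p = z≤n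
  bound {suc a} p = p a (n<1+n a)

-- A Square consists of the partitions at the corners of a cell with entry t
-- (ρ south-west, μ north-west, ν south-east, π north-east) of a growth diagram;
-- these are Fomin's local rules in piecewise linear form.
record Square (t : ℕ) (ρ μ ν π : ℕ → ℕ) : Set where
  field
    first : π 0 ≡ (μ 0 ⊔ ν 0) + t
    rest  : ∀ r → ρ r + π (suc r) ≡ (μ r ⊓ ν r) + (μ (suc r) ⊔ ν (suc r))

Square-sym : ∀ {t ρ μ ν π} → Square t ρ μ ν π → Square t ρ ν μ π
Square-sym {t} {ρ} {μ} {ν} sq = record
  { first = trans first (cong (_+ t) (⊔-comm (μ 0) (ν 0)))
  ; rest  = λ r → trans (rest r) (cong₂ _+_ (⊓-comm (μ r) (ν r)) (⊔-comm (μ (suc r)) (ν (suc r))))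
  }
  where open Square sq

Square-unique : ∀ {t t′ ρ ρ′ μ μ′ ν ν′ π π′} → Square t ρ μ ν π → Square t′ ρ′ μ′ ν′ π′ →
  t ≡ t′ → (∀ r → ρ r ≡ ρ′ r) → (∀ r → μ r ≡ μ′ r) → (∀ r → ν r ≡ ν′ r) → ∀ r → π r ≡ π′ r
Square-unique {t} {t′} {ρ} {ρ′} {μ} {μ′} {ν} {ν′} {π} {π′} sq sq′ et eρ eμ eν = go
  where
  module S = Square sq
  module S′ = Square sq′
  go : ∀ r → π r ≡ π′ r
  go zero    = trans S.first (trans (cong₂ _+_ (cong₂ _⊔_ (eμ 0) (eν 0)) et) (sym S′.first))
  go (suc r) = +-cancelˡ-≡ (ρ r) _ _ (trans (S.rest r)
    (trans (cong₂ _+_ (cong₂ _⊓_ (eμ r) (eν r)) (cong₂ _⊔_ (eμ (suc r)) (eν (suc r))))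
    (trans (sym (S′.rest r)) (cong (_+ π′ (suc r)) (sym (eρ r))))))

-- The rules telescope: the maximum at `n` from one rule and the minimum at `n` from the next
-- recombine to `μ n + ν n`. The loose ends at `n` disappear once `n` is past all parts.
Square-sum : ∀ {t ρ μ ν π} → Square t ρ μ ν π → ∀ n →
  (∑ n ρ + ∑ n π) + π n ≡ ((∑ n μ + ∑ n ν) + t) + (μ n ⊔ ν n)
Square-sum {t} {ρ} {μ} {ν} {π} sq zero    = trans (Square.first sq) (+-comm _ t)
Square-sum {t} {ρ} {μ} {ν} {π} sq (suc n) = begin
  ((R + ρ n) + (P + π n)) + π (suc n)
    ≡⟨ e₁ R (ρ n) P (π n) (π (suc n)) ⟩
  ((R + P) + π n) + (ρ n + π (suc n))
    ≡⟨ cong₂ _+_ (Square-sum sq n) (Square.rest sq n) ⟩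
  (((U + V) + t) + (μ n ⊔ ν n)) + ((μ n ⊓ ν n) + (μ (suc n) ⊔ ν (suc n)))
    ≡⟨ e₂ ((U + V) + t) (μ n ⊔ ν n) (μ n ⊓ ν n) (μ (suc n) ⊔ ν (suc n)) ⟩
  (((U + V) + t) + ((μ n ⊔ ν n) + (μ n ⊓ ν n))) + (μ (suc n) ⊔ ν (suc n))
    ≡⟨ cong (λ z → (((U + V) + t) + z) + (μ (suc n) ⊔ ν (suc n))) (⊔+⊓ (μ n) (ν n)) ⟩
  (((U + V) + t) + (μ n + ν n)) + (μ (suc n) ⊔ ν (suc n))
    ≡⟨ cong (_+ (μ (suc n) ⊔ ν (suc n))) (e₃ U V t (μ n) (ν n)) ⟩
  (((U + μ n) + (V + ν n)) + t) + (μ (suc n) ⊔ ν (suc n)) ∎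
  where
  open ≡-Reasoning
  R = ∑ n ρ
  P = ∑ n π
  U = ∑ n μ
  V = ∑ n ν
  e₁ : ∀ a b c d e → ((a + b) + (c + d)) + e ≡ ((a + c) + d) + (b + e)
  e₁ = solve-∀
  e₂ : ∀ a b c d → (a + b) + (c + d) ≡ (a + (b + c)) + d
  e₂ = solve-∀
  e₃ : ∀ u v t a b → ((u + v) + t) + (a + b) ≡ ((u + a) + (v + b)) + t
  e₃ = solve-∀

-- Partitions in a box, their conjugates and one-box edges

module Partitions (M : ℕ) where

  size : (ℕ → ℕ) → ℕ
  size = ∑ M

  -- partitions inside an M × M box
  record Part (f : ℕ → ℕ) : Set where
    field
      dec   : ∀ r → f (suc r) ≤ f r
      bound : f 0 ≤ M
      end   : f M ≡ 0

    dec* : ∀ {r s} → r ≤ s → f s ≤ f r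
    dec* {r} r≤s = go (≤⇒≤′ r≤s)
      where
      go : ∀ {s} → r ≤′ s → f s ≤ f r
      go ≤′-refl     = ≤-refl
      go (≤′-step p) = ≤-trans (dec _) (go p)

    bound* : ∀ r → f r ≤ M
    bound* r = ≤-trans (dec* z≤n) bound

    end* : ∀ {r c} → c < f r → r < M
    end* {r} c<f = ≰⇒> λ M≤r → <⇒≱ c<f (≤-trans (dec* M≤r) (≤-trans (≤-reflexive end) z≤n))

  conj : (ℕ → ℕ) → ℕ → ℕ
  conj f c = ∑ M (λ r → ind c (f r))

  conj-cong : ∀ {f g} → (∀ r → f r ≡ g r) → ∀ c → conj f c ≡ conj g c
  conj-cong e c = ∑-cong M λ r _ → cong (ind c) (e r)

  conj-⇒ : ∀ {f} → Part f → ∀ {r c} → c < f r → r < conj f c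
  conj-⇒ {f} pf {r} {c} c<f = ≤-trans (≤-reflexive (sym (∑-ones (suc r) λ s s≤r → ind-< (≤-trans c<f (dec* (s≤s⁻¹ s≤r))))))
                                      (∑-extend (λ s → ind c (f s)) (end* c<f))
    where open Part pf

  conj-⇐ : ∀ {f} → Part f → ∀ {r c} → r < conj f c → c < f r
  conj-⇐ {f} pf {r} {c} r<c with c <? f r
  ... | yes p = p
  ... | no ¬p = ⊥-elim (<⇒≱ r<c (∑-support M r (λ s → ind≤1 c (f s)) λ s r≤s → ind-≥ (≤-trans (dec* r≤s) (≮⇒≥ ¬p))))
    where open Part pf

  conj-Part : ∀ {f} → Part f → Part (conj f)
  conj-Part {f} pf = record
    { dec   = λ c → ∑-mono-≤ M λ r _ → ind-dec c (f r)
    ; bound = ∑-support M M (λ s → ind≤1 0 (f s)) λ s M≤s → ind-≥ (≤-trans (dec* M≤s) (≤-reflexive end))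
    ; end   = trans (∑-cong M λ r _ → ind-≥ (bound* r)) (∑-zero M)
    }
    where
    open Part pf
    ind-dec : ∀ c n → ind (suc c) n ≤ ind c n
    ind-dec c       zero          = z≤n
    ind-dec zero    (suc n)       = ind≤1 0 n
    ind-dec (suc c) (suc zero)    = z≤n
    ind-dec (suc c) (suc (suc n)) = ind-dec c (suc n)

  conj-involutive : ∀ {f} → Part f → ∀ r → conj (conj f) r ≡ f r
  conj-involutive pf r = ≡-from-<
    (λ c p → conj-⇐ pf (conj-⇐ (conj-Part pf) p))
    (λ c p → conj-⇒ (conj-Part pf) (conj-⇒ pf p))

  size-conj : ∀ {f} → Part f → size (conj f) ≡ size f
  size-conj {f} pf = trans (∑-swap M M (λ c r → ind c (f r)))
    (∑-cong M λ r _ → trans (∑-ind M (f r)) (m≥n⇒m⊓n≡n (bound* r)))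
    where open Part pf

  -- π / μ is a horizontal strip with at most one box
  record Edge (μ π : ℕ → ℕ) : Set where
    field
      sub   : ∀ r → μ r ≤ π r
      inter : ∀ r → π (suc r) ≤ μ r
      size≤ : size π ≤ suc (size μ)

  Edge-cong : ∀ {μ μ′ π π′} → (∀ r → μ r ≡ μ′ r) → (∀ r → π r ≡ π′ r) → Edge μ π → Edge μ′ π′
  Edge-cong eμ eπ e = record
    { sub   = λ r → subst₂ _≤_ (eμ r) (eπ r) (sub r)
    ; inter = λ r → subst₂ _≤_ (eπ (suc r)) (eμ r) (inter r)
    ; size≤ = subst₂ (λ a b → a ≤ suc b) (∑-cong M λ r _ → eπ r) (∑-cong M λ r _ → eμ r) size≤
    }
    where open Edge e

  -- The interlacing of the conjugates is the vertical strip condition for `μ` and `π`, available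
  -- because one new box cannot lengthen a row by two.
  conj-Edge : ∀ {μ π} → Part μ → Part π → Edge μ π → Edge (conj μ) (conj π)
  conj-Edge {μ} {π} pμ pπ e = record
    { sub   = λ c → ∑-mono-≤ M λ r _ → ind-mono c (sub r)
    ; inter = λ c → ∑-mono-≤ M λ r r<M → ind-mono (suc c) (vertical r r<M)
    ; size≤ = subst₂ (λ a b → a ≤ suc b) (sym (size-conj pπ)) (sym (size-conj pμ)) size≤
    }
    where
    open Edge e
    vertical : ∀ r → r < M → π r ≤ suc (μ r)
    vertical r r<M = +-cancelʳ-≤ (size μ) _ _
      (≤-trans (∑-differ M sub r<M) (≤-trans (+-monoʳ-≤ (μ r) size≤) (≤-reflexive (+-suc (μ r) _))))

  Square-size : ∀ {t ρ μ ν π} → Square t ρ μ ν π → μ M ≡ 0 → ν M ≡ 0 → π M ≡ 0 →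
    size ρ + size π ≡ (size μ + size ν) + t
  Square-size {t} {ρ} {μ} {ν} {π} sq eμ eν eπ = begin
    size ρ + size π                                ≡⟨ sym (+-identityʳ _) ⟩
    (size ρ + size π) + 0                          ≡⟨ cong ((size ρ + size π) +_) (sym eπ) ⟩
    (size ρ + size π) + π M                        ≡⟨ Square-sum sq M ⟩
    ((size μ + size ν) + t) + (μ M ⊔ ν M)          ≡⟨ cong (((size μ + size ν) + t) +_) (cong₂ _⊔_ eμ eν) ⟩
    ((size μ + size ν) + t) + 0                    ≡⟨ +-identityʳ _ ⟩
    (size μ + size ν) + t                          ∎
    where open ≡-Reasoning

  -- Carries edges backwards across a square. For the size bound, `Square-size` with `t` at least 0
  -- transfers the bound from the opposite edge, `ν` to `π`.
  Square-Edge : ∀ {t ρ μ ν π} → Square t ρ μ ν π → Edge μ π → Edge ν π → π M ≡ 0 → Edge ρ μ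
  Square-Edge {t} {ρ} {μ} {ν} {π} sq eμ eν eπ = record
    { sub   = λ r → +-cancelʳ-≤ (π (suc r)) _ _ (≤-trans (≤-reflexive (rest r))
                (+-mono-≤ (m⊓n≤m (μ r) (ν r)) (⊔-lub (Edge.sub eμ (suc r)) (Edge.sub eν (suc r)))))
    ; inter = λ r → +-cancelˡ-≤ (π (suc r)) _ _ (≤-trans
                (+-mono-≤ (⊓-glb (Edge.inter eμ r) (Edge.inter eν r)) (m≤m⊔n (μ (suc r)) (ν (suc r))))
                (≤-trans (≤-reflexive (sym (rest r))) (≤-reflexive (+-comm (ρ r) _))))
    ; size≤ = +-cancelʳ-≤ (size ν) _ _ (begin
        size μ + size ν          ≤⟨ m≤m+n _ t ⟩
        (size μ + size ν) + t    ≡⟨ sym (Square-size sq (vanish eμ) (vanish eν) eπ) ⟩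
        size ρ + size π          ≤⟨ +-monoʳ-≤ (size ρ) (Edge.size≤ eν) ⟩
        size ρ + suc (size ν)    ≡⟨ +-suc (size ρ) _ ⟩
        suc (size ρ) + size ν    ∎)
    }
    where
    open Square sq
    open ≤-Reasoning
    vanish : ∀ {μ} → Edge μ π → μ M ≡ 0
    vanish e = n≤0⇒n≡0 (≤-trans (Edge.sub e M) (≤-reflexive eπ))

-- Growth diagrams

Λ : Grid → ℕ → ℕ → ℕ → ℕ
Λ S x y r = L (∂^ r S) x y

Λ-Square : ∀ S x y → Square (S x y) (Λ S x y) (Λ S x (suc y)) (Λ S (suc x) y) (Λ S (suc x) (suc y))
Λ-Square S x y = record { first = refl ; rest = eq }
  where
  eq : ∀ r → Λ S x y r + Λ S (suc x) (suc y) (suc r) ≡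
             (Λ S x (suc y) r ⊓ Λ S (suc x) y r) + (Λ S x (suc y) (suc r) ⊔ Λ S (suc x) y (suc r))
  eq r rewrite ∂^-suc r S = trans (rearrange (L C x y) _ (∂ C x y)) (cong (_+ (L (∂ C) x (suc y) ⊔ L (∂ C) (suc x) y)) (∂-eq C x y))
    where
    C = ∂^ r S
    rearrange : ∀ a b c → a + (b + c) ≡ (a + c) + b
    rearrange = solve-∀

Λ-interˣ : ∀ S x y r → Λ S (suc x) y (suc r) ≤ Λ S x y r
Λ-interˣ S x y r rewrite ∂^-suc r S = proj₁ (L-∂-interlace (∂^ r S) x y)

Λ-interʸ : ∀ S x y r → Λ S x (suc y) (suc r) ≤ Λ S x y r
Λ-interʸ S x y r rewrite ∂^-suc r S = proj₂ (L-∂-interlace (∂^ r S) x y)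

Λ-vanish : ∀ S {x r} y → x ≤ r → Λ S x y r ≡ 0
Λ-vanish S {zero}          y p       = refl
Λ-vanish S {suc x} {suc r} y (s≤s p) = n≤0⇒n≡0 (≤-trans (Λ-interˣ S x y r) (≤-reflexive (Λ-vanish S y p)))

Λ-zeroʳ : ∀ S x r → Λ S x 0 r ≡ 0
Λ-zeroʳ S x r = L-zeroʳ (∂^ r S) x

Λ-transpose : ∀ {S} → (∀ x y → S x y ≡ S y x) → ∀ x y r → Λ S x y r ≡ Λ S y x r
Λ-transpose {S} sym-S x y r = L-transpose (go r S sym-S) x y
  where
  go : ∀ r B → (∀ x y → B x y ≡ B y x) → ∀ x y → ∂^ r B x y ≡ ∂^ r B y x
  go zero    B e = e
  go (suc r) B e = go r (∂ B) (∂-transpose e)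

Λ-cong : ∀ {S S′} → (∀ x y → S x y ≡ S′ x y) → ∀ x y r → Λ S x y r ≡ Λ S′ x y r
Λ-cong {S} {S′} e x y r = L-cong (go r S S′ e) x y
  where
  go : ∀ r B C → (∀ x y → B x y ≡ C x y) → ∀ x y → ∂^ r B x y ≡ ∂^ r C x y
  go zero    B C e = e
  go (suc r) B C e = go r (∂ B) (∂ C) (∂-cong e)

L≤width : ∀ {B} → PP B → ∀ x y → L B x y ≤ x
L≤width pp zero    y = z≤n
L≤width {B} pp (suc x) y = begin
  L B (suc x) y                   ≤⟨ m≤m+n _ _ ⟩
  L B (suc x) y + colSum (∂ B) x y   ≡⟨ col-L B x y ⟩
  L B x y + colSum B x y             ≤⟨ +-mono-≤ (L≤width pp x y) (col≤1 pp x y) ⟩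
  x + 1                           ≡⟨ +-comm x 1 ⟩
  suc x                           ∎
  where open ≤-Reasoning

-- Sizes and edges in the growth diagram of a filling

module Corners (M : ℕ) where
  open Partitions M

  Λ-Part : ∀ {S} → PP S → ∀ {x} y → x ≤ M → Part (Λ S x y)
  Λ-Part {S} pp {x} y x≤M = record
    { dec   = λ r → ≤-trans (L-stepˣ (∂^ (suc r) S) x y) (Λ-interˣ S x y r)
    ; bound = ≤-trans (L≤width pp x y) x≤M
    ; end   = Λ-vanish S y x≤M
    }

  -- Difference form of the fact that the partition at a point has as many boxes as there are 1s
  -- south-west of it; the induction climbs a column of squares.
  size-col : ∀ S {x} y → suc x ≤ M → size (Λ S (suc x) y) ≡ size (Λ S x y) + colSum S x y
  size-col S {x} zero    p = trans (∑-cong M λ r _ → trans (Λ-zeroʳ S (suc x) r) (sym (Λ-zeroʳ S x r))) (sym (+-identityʳ _))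
  size-col S {x} (suc y) p = +-cancelˡ-≡ (size (Λ S x y)) _ _ (begin
    a + size (Λ S (suc x) (suc y))      ≡⟨ Square-size (Λ-Square S x y) (Λ-vanish S (suc y) (<⇒≤ p)) (Λ-vanish S y p) (Λ-vanish S (suc y) p) ⟩
    (b + size (Λ S (suc x) y)) + t      ≡⟨ cong (λ z → (b + z) + t) (size-col S y p) ⟩
    (b + (a + c)) + t                   ≡⟨ rearrange a b c t ⟩
    a + (b + (c + t))                   ∎)
    where
    open ≡-Reasoning
    a = size (Λ S x y)
    b = size (Λ S x (suc y))
    c = colSum S x y
    t = S x y
    rearrange : ∀ a b c t → (b + (a + c)) + t ≡ a + (b + (c + t))
    rearrange = solve-∀

  size-row : ∀ S {x} y → x ≤ M → size (Λ S x (suc y)) ≡ size (Λ S x y) + rowSum S x y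
  size-row S {zero}  y p = sym (+-identityʳ _)
  size-row S {suc x} y p = +-cancelˡ-≡ (size (Λ S x y)) _ _ (begin
    a + size (Λ S (suc x) (suc y))      ≡⟨ Square-size (Λ-Square S x y) (Λ-vanish S (suc y) (<⇒≤ p)) (Λ-vanish S y p) (Λ-vanish S (suc y) p) ⟩
    (size (Λ S x (suc y)) + b) + t      ≡⟨ cong (λ z → (z + b) + t) (size-row S y (<⇒≤ p)) ⟩
    ((a + c) + b) + t                   ≡⟨ rearrange a b c t ⟩
    a + (b + (c + t))                   ∎)
    where
    open ≡-Reasoning
    a = size (Λ S x y)
    b = size (Λ S (suc x) y)
    c = rowSum S x y
    t = S x y
    rearrange : ∀ a b c t → ((a + c) + b) + t ≡ a + (b + (c + t))
    rearrange = solve-∀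

  Λ-Edgeˣ : ∀ {S} → PP S → ∀ {x} y → suc x ≤ M → Edge (Λ S x y) (Λ S (suc x) y)
  Λ-Edgeˣ {S} pp {x} y p = record
    { sub   = λ r → L-stepˣ (∂^ r S) x y
    ; inter = Λ-interˣ S x y
    ; size≤ = ≤-trans (≤-reflexive (size-col S y p)) (≤-trans (+-monoʳ-≤ _ (col≤1 pp x y)) (≤-reflexive (+-comm _ 1)))
    }

  Λ-Edgeʸ : ∀ {S} → PP S → ∀ {x} y → x ≤ M → Edge (Λ S x y) (Λ S x (suc y))
  Λ-Edgeʸ {S} pp {x} y p = record
    { sub   = λ r → L-stepʸ (∂^ r S) x y
    ; inter = Λ-interʸ S x y
    ; size≤ = ≤-trans (≤-reflexive (size-row S y p)) (≤-trans (+-monoʳ-≤ _ (row≤1 pp x y)) (≤-reflexive (+-comm _ 1)))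
    }

-- Growth diagrams on a symmetric Ferrers shape with column heights H

module Ferrers (M : ℕ) (H : ℕ → ℕ)
               (H-dec : ∀ x → H (suc x) ≤ H x)
               (H<M   : ∀ x → H x < M)
               (H-sym : ∀ x y → y < H x → x < H y) where
  open Partitions M
  open Corners M

  -- A lattice point is classified by the cell whose south-west corner it is, so `¬ F x y` covers
  -- the north-east boundary and the exterior alike.
  F : ℕ → ℕ → Set
  F x y = y < H x

  F-boundˣ : ∀ {x y} → F x y → suc x < M
  F-boundˣ {x} {y} f = <-≤-trans (s≤s (H-sym x y f)) (H<M y)

  F-boundʸ : ∀ {x y} → F x y → suc y < M
  F-boundʸ {x} {y} f = <-≤-trans (s≤s f) (H<M x)

  -- The lattice points of the closed shape, including both axes.
  Closed : ℕ → ℕ → Set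
  Closed zero    y = ⊤
  Closed (suc x) y = y ≤ H x

  Closed-left : ∀ x {y} → y ≤ H x → Closed x y
  Closed-left zero    p = tt
  Closed-left (suc x) p = ≤-trans p (H-dec x)

  -- Every recursive call raises `x + y`, and cells of `F` have `x + y` below `M + M`; fuel `M + M`
  -- therefore never runs out inside `F`.
  Fueled : ℕ → ℕ → ℕ → Set
  Fueled d x y = M + M ≤ d + (x + y)

  Fueledˣ : ∀ {d x y} → Fueled (suc d) x y → Fueled d (suc x) y
  Fueledˣ {d} {x} {y} le = ≤-trans le (≤-reflexive (sym (+-suc d (x + y))))

  Fueledʸ : ∀ {d x y} → Fueled (suc d) x y → Fueled d x (suc y)
  Fueledʸ {d} {x} {y} le = ≤-trans (Fueledˣ {d} {x} {y} le) (≤-reflexive (cong (d +_) (sym (+-suc x y))))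

  Fueledˣʸ : ∀ {d x y} → Fueled (suc d) x y → Fueled d (suc x) (suc y)
  Fueledˣʸ {d} {x} {y} le = ≤-trans (Fueledʸ {d} {x} {y} le) (+-monoʳ-≤ d (n≤1+n _))

  backward-induction : (P : ℕ → ℕ → Set) →
    (∀ x y → x < M → y < M → ¬ F x y → P x y) →
    (∀ x y → F x y → P x (suc y) → P (suc x) y → P (suc x) (suc y) → P x y) →
    ∀ x y → x < M → y < M → P x y
  backward-induction P base step x y x<M y<M = go (M + M) x y x<M y<M (m≤m+n _ _)
    where
    go : ∀ d x y → x < M → y < M → Fueled d x y → P x y
    go zero    x y x<M y<M le = ⊥-elim (<⇒≱ (+-mono-< x<M y<M) le)
    go (suc d) x y x<M y<M le with y <? H x
    ... | no ¬f = base x y x<M y<M ¬f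
    ... | yes f = step x y f
      (go d x (suc y) x<M (F-boundʸ f) (Fueledʸ {d} {x} le))
      (go d (suc x) y (F-boundˣ f) y<M (Fueledˣ {d} {x} le))
      (go d (suc x) (suc y) (F-boundˣ f) (F-boundʸ f) (Fueledˣʸ {d} {x} le))

  -- the south-west partition of a square, recovered from the other three
  back : (μ ν π : ℕ → ℕ) → ℕ → ℕ
  back μ ν π r = ((μ r ⊓ ν r) + (μ (suc r) ⊔ ν (suc r))) ∸ π (suc r)

  back-cong : ∀ {μ μ′ ν ν′ π π′} → (∀ r → μ r ≡ μ′ r) → (∀ r → ν r ≡ ν′ r) → (∀ r → π r ≡ π′ r) →
    ∀ r → back μ ν π r ≡ back μ′ ν′ π′ r
  back-cong eμ eν eπ r = cong₂ _∸_
    (cong₂ _+_ (cong₂ _⊓_ (eμ r) (eν r)) (cong₂ _⊔_ (eμ (suc r)) (eν (suc r)))) (eπ (suc r))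

  back-comm : ∀ μ ν π r → back μ ν π r ≡ back ν μ π r
  back-comm μ ν π r = cong (_∸ π (suc r)) (cong₂ _+_ (⊓-comm (μ r) (ν r)) (⊔-comm (μ (suc r)) (ν (suc r))))

  back-Square : ∀ {t ρ μ ν π} → Square t ρ μ ν π → ∀ r → ρ r ≡ back μ ν π r
  back-Square {ρ = ρ} {π = π} sq r =
    trans (sym (m+n∸n≡m (ρ r) (π (suc r)))) (cong (_∸ π (suc r)) (Square.rest sq r))

  -- The edges make both truncated subtractions exact: `sub` for the entry, `inter` for the
  -- south-west partition.
  Square-back : ∀ {μ ν π} → Edge μ π → Edge ν π → Square (π 0 ∸ (μ 0 ⊔ ν 0)) (back μ ν π) μ ν π
  Square-back eμ eν = record
    { first = sym (m+[n∸m]≡n (⊔-lub (Edge.sub eμ 0) (Edge.sub eν 0)))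
    ; rest  = λ r → m∸n+n≡m (≤-trans (⊓-glb (Edge.inter eμ r) (Edge.inter eν r)) (m≤m+n _ _))
    }

  -- The backward growth diagram with the partitions K prescribed off F;
  -- the first argument is fuel.
  grow : (ℕ → ℕ → ℕ → ℕ) → ℕ → ℕ → ℕ → ℕ → ℕ
  grow K zero    x y = K x y
  grow K (suc d) x y with y <? H x
  ... | yes _ = back (grow K d x (suc y)) (grow K d (suc x) y) (grow K d (suc x) (suc y))
  ... | no  _ = K x y

  grow-off : ∀ K d {x y} → ¬ F x y → ∀ r → grow K d x y r ≡ K x y r
  grow-off K zero    ¬f r = refl
  grow-off K (suc d) {x} {y} ¬f r with y <? H x
  ... | yes f = ⊥-elim (¬f f)
  ... | no  _ = refl

  grow-on : ∀ K d {x y} → F x y → ∀ r →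
    grow K (suc d) x y r ≡ back (grow K d x (suc y)) (grow K d (suc x) y) (grow K d (suc x) (suc y)) r
  grow-on K d {x} {y} f r with y <? H x
  ... | yes _ = refl
  ... | no ¬f = ⊥-elim (¬f f)

  ¬Fueled0 : ∀ {x y} → F x y → ¬ Fueled 0 x y
  ¬Fueled0 f le = <⇒≱ (+-mono-< (<⇒≤ (F-boundˣ f)) (<⇒≤ (F-boundʸ f))) le

  -- Lets `Q-on` unfold one step at fuel `suc (M + M)` and still have the same `Q` on both sides.
  grow-fuel : ∀ K d e x y → Fueled d x y → Fueled e x y → ∀ r → grow K d x y r ≡ grow K e x y r
  grow-fuel K d e x y p q r with y <? H x
  ... | no ¬f = trans (grow-off K d ¬f r) (sym (grow-off K e ¬f r))
  grow-fuel K zero    e       x y p q r | yes f = ⊥-elim (¬Fueled0 f p)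
  grow-fuel K (suc d) zero    x y p q r | yes f = ⊥-elim (¬Fueled0 f q)
  grow-fuel K (suc d) (suc e) x y p q r | yes f = trans (grow-on K d f r) (trans
    (back-cong (grow-fuel K d e x (suc y) (Fueledʸ {d} {x} p) (Fueledʸ {e} {x} q))
               (grow-fuel K d e (suc x) y (Fueledˣ {d} {x} p) (Fueledˣ {e} {x} q))
               (grow-fuel K d e (suc x) (suc y) (Fueledˣʸ {d} {x} p) (Fueledˣʸ {e} {x} q)) r)
    (sym (grow-on K e f r)))

  Q : (ℕ → ℕ → ℕ → ℕ) → ℕ → ℕ → ℕ → ℕ
  Q K = grow K (M + M)

  Q-on : ∀ K {x y} → F x y → ∀ r → Q K x y r ≡ back (Q K x (suc y)) (Q K (suc x) y) (Q K (suc x) (suc y)) r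
  Q-on K {x} {y} f r =
    trans (grow-fuel K (M + M) (suc (M + M)) x y (m≤m+n _ _) (m≤n⇒m≤1+n (m≤m+n _ _)) r) (grow-on K (M + M) f r)

  Q-transpose : ∀ {K} → (∀ x y r → K x y r ≡ K y x r) → ∀ x y r → Q K x y r ≡ Q K y x r
  Q-transpose {K} e = go (M + M)
    where
    go : ∀ d x y r → grow K d x y r ≡ grow K d y x r
    go zero    x y r = e x y r
    go (suc d) x y r with y <? H x
    ... | no ¬f = trans (e x y r) (sym (grow-off K (suc d) (λ f → ¬f (H-sym y x f)) r))
    ... | yes f = trans (back-cong (go d x (suc y)) (go d (suc x) y) (go d (suc x) (suc y)) r)
                 (trans (back-comm (grow K d (suc y) x) (grow K d y (suc x)) (grow K d (suc y) (suc x)) r) (sym (grow-on K d (H-sym x y f) r)))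

  -- The local rule `first` solved for the entry of the cell.
  Φ-from : (ℕ → ℕ → ℕ → ℕ) → Grid
  Φ-from K x y with y <? H x
  ... | yes _ = Q K (suc x) (suc y) 0 ∸ (Q K x (suc y) 0 ⊔ Q K (suc x) y 0)
  ... | no  _ = 0

  Φ-on : ∀ K {x y} → F x y → Φ-from K x y ≡ Q K (suc x) (suc y) 0 ∸ (Q K x (suc y) 0 ⊔ Q K (suc x) y 0)
  Φ-on K {x} {y} f with y <? H x
  ... | yes _ = refl
  ... | no ¬f = ⊥-elim (¬f f)

  Φ-off : ∀ K {x y} → ¬ F x y → Φ-from K x y ≡ 0
  Φ-off K {x} {y} ¬f with y <? H x
  ... | yes f = ⊥-elim (¬f f)
  ... | no  _ = refl

  κ : Grid → ℕ → ℕ → ℕ → ℕ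
  κ S x y = conj (Λ S x y)

  Φ : Grid → Grid
  Φ S = Φ-from (κ S)

  Φ-cong : ∀ {S S′} → (∀ x y → S x y ≡ S′ x y) → ∀ x y → Φ S x y ≡ Φ S′ x y
  Φ-cong {S} {S′} e x y with y <? H x
  ... | no  _ = refl
  ... | yes _ = cong₂ _∸_ (go (M + M) (suc x) (suc y) 0)
                          (cong₂ _⊔_ (go (M + M) x (suc y) 0) (go (M + M) (suc x) y 0))
    where
    eκ : ∀ x y r → κ S x y r ≡ κ S′ x y r
    eκ x y = conj-cong (Λ-cong e x y)
    go : ∀ d x y r → grow (κ S) d x y r ≡ grow (κ S′) d x y r
    go zero    x y r = eκ x y r
    go (suc d) x y r with y <? H x
    ... | no  _ = eκ x y r
    ... | yes _ = back-cong (go d x (suc y)) (go d (suc x) y) (go d (suc x) (suc y)) r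

  record Filling (S : Grid) : Set where
    field
      pp        : PP S
      symmetric : ∀ x y → S x y ≡ S y x
      support   : ∀ x y → ¬ F x y → S x y ≡ 0

  Filling-cong : ∀ {S S′} → (∀ x y → S x y ≡ S′ x y) → Filling S → Filling S′
  Filling-cong {S} {S′} e fil = record
    { pp = record
      { row≤1 = λ x y → subst (_≤ 1) (∑-cong x λ j _ → e j y) (row≤1 pp x y)
      ; col≤1 = λ x y → subst (_≤ 1) (∑-cong y λ i _ → e x i) (col≤1 pp x y)
      }
    ; symmetric = λ x y → trans (sym (e x y)) (trans (symmetric x y) (e y x))
    ; support   = λ x y ¬f → trans (sym (e x y)) (support x y ¬f)
    }
    where open Filling fil

  module _ {S : Grid} (fil : Filling S) where
    open Filling fil

    private
      q : ℕ → ℕ → ℕ → ℕ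
      q = Q (κ S)
      U : Grid
      U = Φ S

    Good : ℕ → ℕ → Set
    Good x y = Edge (q x y) (q (suc x) y) × Edge (q x y) (q x (suc y)) × q x y M ≡ 0

    off : ∀ {x y} → ¬ F x y → ∀ r → q x y r ≡ κ S x y r
    off = grow-off (κ S) (M + M)

    good : ∀ x y → x < M → y < M → Good x y
    good-Square : ∀ {x y} → F x y → Good x (suc y) → Good (suc x) y → Square (U x y) (q x y) (q x (suc y)) (q (suc x) y) (q (suc x) (suc y))

    good-Square {x} {y} f (eμ , _) (_ , eν , _) = record
      { first = trans (Square.first sq) (cong ((q x (suc y) 0 ⊔ q (suc x) y 0) +_) (sym (Φ-on (κ S) f)))
      ; rest  = λ r → trans (cong (_+ q (suc x) (suc y) (suc r)) (Q-on (κ S) f r)) (Square.rest sq r)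
      }
      where sq = Square-back eμ eν

    good = backward-induction Good base step
      where
      base : ∀ x y → x < M → y < M → ¬ F x y → Good x y
      -- The points to the right and above are off `F` as well, so these edges are conjugates of
      -- edges of `Λ S`.
      base x y x<M y<M ¬f =
          Edge-cong (λ r → sym (off ¬f r)) (λ r → sym (off (λ f → ¬f (≤-trans f (H-dec x))) r))
            (conj-Edge (Λ-Part pp y (<⇒≤ x<M)) (Λ-Part pp y x<M) (Λ-Edgeˣ pp y x<M))
        , Edge-cong (λ r → sym (off ¬f r)) (λ r → sym (off (λ f → ¬f (<⇒≤ f)) r))
            (conj-Edge (Λ-Part pp y (<⇒≤ x<M)) (Λ-Part pp (suc y) (<⇒≤ x<M)) (Λ-Edgeʸ pp y (<⇒≤ x<M)))
        , trans (off ¬f M) (Part.end (conj-Part (Λ-Part pp y (<⇒≤ x<M))))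
      step : ∀ x y → F x y → Good x (suc y) → Good (suc x) y → Good (suc x) (suc y) → Good x y
      step x y f gμ@(eμ , _ , zμ) gν@(_ , eν , _) (_ , _ , zπ) =
        eρν , eρμ , n≤0⇒n≡0 (≤-trans (Edge.sub eρμ M) (≤-reflexive zμ))
        where
        sq = good-Square f gμ gν
        eρμ = Square-Edge sq eμ eν zπ
        eρν = Square-Edge (Square-sym sq) eν eμ zπ

    Q-Square : ∀ {x y} → F x y → Square (U x y) (q x y) (q x (suc y)) (q (suc x) y) (q (suc x) (suc y))
    Q-Square {x} {y} f = good-Square f
      (good x (suc y) (<⇒≤ (F-boundˣ f)) (F-boundʸ f)) (good (suc x) y (F-boundˣ f) (<⇒≤ (F-boundʸ f)))

    κ-transpose : ∀ x y r → κ S x y r ≡ κ S y x r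
    κ-transpose x y = conj-cong (Λ-transpose symmetric x y)

    -- Inside `F` the axis values are computed, not prescribed: the empty partition is forced down
    -- from the boundary by containment along edges. These are the initial values for `Λ-Φ`.
    Q-zeroˡ : ∀ y → y < M → ∀ r → q 0 y r ≡ 0
    Q-zeroˡ y y<M r = backward-induction (λ x y → x ≡ 0 → q x y r ≡ 0) base step 0 y (≤-<-trans z≤n y<M) y<M refl
      where
      base : ∀ x y → x < M → y < M → ¬ F x y → x ≡ 0 → q x y r ≡ 0
      base .0 y _ _ ¬f refl = trans (off ¬f r) (∑-zero M)
      step : ∀ x y → F x y → (x ≡ 0 → q x (suc y) r ≡ 0) → _ → _ → x ≡ 0 → q x y r ≡ 0
      step x y f z _ _ e = n≤0⇒n≡0 (≤-trans
        (Edge.sub (proj₁ (proj₂ (good x y (<⇒≤ (F-boundˣ f)) (<⇒≤ (F-boundʸ f))))) r) (≤-reflexive (z e)))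

    Q-zeroʳ : ∀ x → x < M → ∀ r → q x 0 r ≡ 0
    Q-zeroʳ x x<M r = trans (Q-transpose κ-transpose x 0 r) (Q-zeroˡ x x<M r)

    Φ-symmetric : ∀ x y → U x y ≡ U y x
    Φ-symmetric x y with y <? H x
    ... | no ¬f = sym (Φ-off (κ S) (λ f → ¬f (H-sym y x f)))
    ... | yes f = sym (trans (Φ-on (κ S) (H-sym x y f))
      (cong₂ _∸_ (tr (suc y) (suc x) 0)
                 (trans (cong₂ _⊔_ (tr y (suc x) 0) (tr (suc y) x 0)) (⊔-comm (q (suc x) y 0) (q x (suc y) 0)))))
      where tr = Q-transpose κ-transpose

    -- Both diagrams start empty on the axes and obey the local rules with the same entries.
    -- `Closed` keeps every square used inside `F`; farther out `q` holds prescribed values that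
    -- need not continue the diagram of `U`.
    Λ-Φ : ∀ x y → x < M → y < M → Closed x y → ∀ r → Λ U x y r ≡ q x y r
    Λ-Φ zero    y       x<M y<M c r = sym (Q-zeroˡ y y<M r)
    Λ-Φ (suc x) zero    x<M y<M c r = trans (Λ-zeroʳ U (suc x) r) (sym (Q-zeroʳ (suc x) x<M r))
    Λ-Φ (suc x) (suc y) x<M y<M f   = Square-unique (Λ-Square U x y) (Q-Square f) refl
      (Λ-Φ x y (<⇒≤ x<M) (<⇒≤ y<M) (Closed-left x (<⇒≤ f)))
      (Λ-Φ x (suc y) (<⇒≤ x<M) y<M (Closed-left x f))
      (Λ-Φ (suc x) y x<M (<⇒≤ y<M) (<⇒≤ f))

    -- By `size-col` a column sum is the size jump across an edge of `q`.
    Φ-col≤1 : ∀ x y → colSum U x y ≤ 1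
    Φ-col≤1 x zero    = z≤n
    Φ-col≤1 x (suc y) = cases (y <? H x)
      where
      open ≤-Reasoning
      cases : Dec (F x y) → colSum U x (suc y) ≤ 1
      cases (no ¬f) = ≤-trans (≤-reflexive (trans (cong (colSum U x y +_) (Φ-off (κ S) ¬f)) (+-identityʳ _))) (Φ-col≤1 x y)
      cases (yes f) = +-cancelˡ-≤ (size (Λ U x (suc y))) _ _ (begin
        size (Λ U x (suc y)) + colSum U x (suc y)  ≡⟨ sym (size-col U (suc y) (<⇒≤ (F-boundˣ f))) ⟩
        size (Λ U (suc x) (suc y))              ≡⟨ ∑-cong M (λ r _ → Λ-Φ (suc x) (suc y) (F-boundˣ f) (F-boundʸ f) f r) ⟩
        size (q (suc x) (suc y))                ≤⟨ Edge.size≤ (proj₁ (good x (suc y) (<⇒≤ (F-boundˣ f)) (F-boundʸ f))) ⟩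
        suc (size (q x (suc y)))                ≡⟨ cong suc (sym (∑-cong M (λ r _ → Λ-Φ x (suc y) (<⇒≤ (F-boundˣ f)) (F-boundʸ f) (Closed-left x f) r))) ⟩
        suc (size (Λ U x (suc y)))              ≡⟨ +-comm 1 _ ⟩
        size (Λ U x (suc y)) + 1                ∎)

    Φ-Filling : Filling U
    Φ-Filling = record
      { pp = record
        { row≤1 = λ x y → ≤-trans (≤-reflexive (∑-cong x λ j _ → Φ-symmetric j y)) (Φ-col≤1 y x)
        ; col≤1 = Φ-col≤1
        }
      ; symmetric = Φ-symmetric
      ; support   = λ x y → Φ-off (κ S)
      }

    Λ-Φ-boundary : ∀ {x y} → x < M → y < M → Closed x y → ¬ F x y → ∀ r → Λ U x y r ≡ conj (Λ S x y) r
    Λ-Φ-boundary {x} {y} x<M y<M c ¬f r = trans (Λ-Φ x y x<M y<M c r) (off ¬f r)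

    -- The points `(x , H x)` and `(suc x , H x)` are both on the boundary, where conjugation
    -- preserves sizes; their difference counts the whole column.
    Φ-col : ∀ {x} → suc x < M → colSum U x (H x) ≡ colSum S x (H x)
    Φ-col {x} x<M = +-cancelˡ-≡ (size (Λ U x (H x))) _ _ (begin
      size (Λ U x (H x)) + colSum U x (H x)  ≡⟨ sym (size-col U (H x) (<⇒≤ x<M)) ⟩
      size (Λ U (suc x) (H x))            ≡⟨ size-eq x<M ≤-refl (λ f → <⇒≱ f (H-dec x)) ⟩
      size (Λ S (suc x) (H x))            ≡⟨ size-col S (H x) (<⇒≤ x<M) ⟩
      size (Λ S x (H x)) + colSum S x (H x)  ≡⟨ cong (_+ colSum S x (H x)) (sym (size-eq (<⇒≤ x<M) (Closed-left x ≤-refl) (<-irrefl refl))) ⟩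
      size (Λ U x (H x)) + colSum S x (H x)  ∎)
      where
      open ≡-Reasoning
      size-eq : ∀ {u} → u < M → Closed u (H x) → ¬ F u (H x) → size (Λ U u (H x)) ≡ size (Λ S u (H x))
      size-eq u<M c ¬f = trans (∑-cong M λ r _ → Λ-Φ-boundary u<M (H<M x) c ¬f r) (size-conj (Λ-Part pp (H x) (<⇒≤ u<M)))

  -- On the boundary double conjugation restores `Λ S`, and `Λ S` obeys the same backward rule, so
  -- regrowing recovers it on the closed shape.
  Φ-involutive : ∀ {S} → Filling S → ∀ x y → Φ (Φ S) x y ≡ S x y
  Φ-involutive {S} fil x y with y <? H x
  ... | no ¬f = sym (support x y ¬f)
    where open Filling fil
  ... | yes f = begin
    q (suc x) (suc y) 0 ∸ (q x (suc y) 0 ⊔ q (suc x) y 0)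
      ≡⟨ cong₂ _∸_ (at (suc x) (suc y) (F-boundˣ f) (F-boundʸ f) f)
           (cong₂ _⊔_ (at x (suc y) (<⇒≤ (F-boundˣ f)) (F-boundʸ f) (Closed-left x f))
                      (at (suc x) y (F-boundˣ f) (<⇒≤ (F-boundʸ f)) (<⇒≤ f))) ⟩
    Λ S (suc x) (suc y) 0 ∸ (Λ S x (suc y) 0 ⊔ Λ S (suc x) y 0)
      ≡⟨ m+n∸m≡n (Λ S x (suc y) 0 ⊔ Λ S (suc x) y 0) (S x y) ⟩
    S x y ∎
    where
    open ≡-Reasoning
    open Filling fil
    q = Q (κ (Φ S))
    recovered : ∀ x y → x < M → y < M → Closed x y → ∀ r → q x y r ≡ Λ S x y r
    recovered = backward-induction (λ x y → Closed x y → ∀ r → q x y r ≡ Λ S x y r)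
      (λ x y x<M y<M ¬f c r → trans (grow-off _ (M + M) ¬f r)
        (trans (conj-cong (Λ-Φ-boundary fil x<M y<M c ¬f) r) (conj-involutive (Λ-Part pp y (<⇒≤ x<M)) r)))
      (λ x y f eμ eν eπ _ r → trans (Q-on _ f r)
        (trans (back-cong (eμ (Closed-left x f)) (eν (<⇒≤ f)) (eπ f) r) (sym (back-Square (Λ-Square S x y) r))))
    at : ∀ x y → x < M → y < M → Closed x y → q x y 0 ≡ Λ S x y 0
    at x y x<M y<M c = recovered x y x<M y<M c 0

  -- The chain has length `suc k`, so `k` is the index of the part it concerns. `0 < H x` says that
  -- column `x` exists, which keeps the corner within the box.
  HasNE HasSE : Grid → ℕ → Set
  HasNE S k = ∃ λ x → 0 < H x × NE S (suc x) (H x) 0 0 (suc k)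
  HasSE S k = ∃ λ x → 0 < H x × SE S (suc x) 0 (H x) (suc k)

  HasNE-cong : ∀ {S S′} → (∀ x y → S x y ≡ S′ x y) → ∀ {k} → HasNE S k → HasNE S′ k
  HasNE-cong e (x , pos , c) = x , pos , NE-map (λ u v → subst (0 <_) (e u v)) ≤-refl c

  HasSE-cong : ∀ {S S′} → (∀ x y → S x y ≡ S′ x y) → ∀ {k} → HasSE S k → HasSE S′ k
  HasSE-cong e (x , pos , c) = x , pos , SE-map (λ u v → subst (0 <_) (e u v)) ≤-refl c

  module _ {S : Grid} (fil : Filling S) where
    open Filling fil

    private
      corner : ∀ {x} → 0 < H x → ∀ r → Λ (Φ S) (suc x) (H x) r ≡ conj (Λ S (suc x) (H x)) r
      corner {x} pos = Λ-Φ-boundary fil (F-boundˣ pos) (H<M x) ≤-refl (λ f → <⇒≱ f (H-dec x))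

      part : ∀ {x} → 0 < H x → Part (Λ S (suc x) (H x))
      part {x} pos = Λ-Part pp (H x) (<⇒≤ (F-boundˣ pos))

      toNE : ∀ {B} → PP B → ∀ x {k} → k < Λ B (suc x) (H x) 0 → NE B (suc x) (H x) 0 0 (suc k)
      toNE ppB x {k} lt = subst (NE _ _ _ 0 0) (+-identityʳ (suc k)) (L⇒NE ppB (suc x) (H x) (suc k) lt (nil ≤-refl ≤-refl))

    -- The first part exceeds `k` exactly when part `k` of the conjugate is nonzero; this is the
    -- exchange of the two chain types at a corner.
    HasNE⇒HasSE-Φ : ∀ k → HasNE S k → HasSE (Φ S) k
    HasNE⇒HasSE-Φ k (x , pos , c) = x , pos , L⇒SE k (Filling.pp (Φ-Filling fil)) (suc x) (H x)
      (subst (0 <_) (sym (corner pos k)) (conj-⇒ (part pos) (NE⇒L c)))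

    HasSE⇒HasNE-Φ : ∀ k → HasSE S k → HasNE (Φ S) k
    HasSE⇒HasNE-Φ k (x , pos , c) = x , pos , toNE (Filling.pp (Φ-Filling fil)) x
      (subst (k <_) (sym (corner pos 0)) (conj-⇒ (part pos) (SE⇒L k pp c)))

    HasSE-Φ⇒HasNE : ∀ k → HasSE (Φ S) k → HasNE S k
    HasSE-Φ⇒HasNE k (x , pos , c) = x , pos , toNE pp x
      (conj-⇐ (part pos) (subst (0 <_) (corner pos k) (SE⇒L k (Filling.pp (Φ-Filling fil)) c)))

    HasNE-Φ⇒HasSE : ∀ k → HasNE (Φ S) k → HasSE S k
    HasNE-Φ⇒HasSE k (x , pos , c) = x , pos , L⇒SE k pp (suc x) (H x)
      (conj-⇐ (part pos) (subst (k <_) (corner pos 0) (NE⇒L c)))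

-- Counting by injections

Unique-⊆⇒length≤ : ∀ {A : Set} {xs ys : List A} → Unique xs → (∀ {z} → z ∈ xs → z ∈ ys) → length xs ≤ length ys
Unique-⊆⇒length≤ {xs = []}     _          sub = z≤n
Unique-⊆⇒length≤ {xs = x ∷ xs} (x∉ ∷ uniq) sub with ∈-∃++ (sub (here refl))
... | as , bs , refl = subst (suc (length xs) ≤_)
    (sym (trans (length-++ as) (trans (+-suc _ _) (cong suc (sym (length-++ as))))))
    (s≤s (Unique-⊆⇒length≤ uniq sub′))
  where
  sub′ : ∀ {z} → z ∈ xs → z ∈ as ++ bs
  sub′ z∈ with ∈-++⁻ as (sub (there z∈))
  ... | inj₁ p           = ∈-++⁺ˡ p
  ... | inj₂ (here refl) = ⊥-elim (All.lookup x∉ z∈ refl)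
  ... | inj₂ (there p)   = ∈-++⁺ʳ as p

Unique-map : ∀ {A B : Set} (f : A → B) {xs} → Unique xs →
  (∀ {x y} → x ∈ xs → y ∈ xs → f x ≡ f y → x ≡ y) → Unique (map f xs)
Unique-map f []          inj = []
Unique-map f (x∉ ∷ uniq) inj =
  AllP.map⁺ (All.tabulate λ y∈ eq → All.lookup x∉ y∈ (inj (here refl) (there y∈) eq))
  ∷ Unique-map f uniq (λ p q → inj (there p) (there q))

-- Injectivity on the filtered elements comes from `f` undoing itself there. Exchanging `s` and `t`
-- later supplies the opposite inequality.
filterᵇ-involution : ∀ {A : Set} {xs : List A} → Unique xs → (p q : A → Bool) (f : A → A) →
  (∀ {x} → x ∈ xs → T (p x) → f x ∈ xs × T (q (f x)) × f (f x) ≡ x) →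
  length (filterᵇ p xs) ≤ length (filterᵇ q xs)
filterᵇ-involution {xs = xs} uniq p q f prop = subst (_≤ length (filterᵇ q xs)) (length-map f (filterᵇ p xs))
  (Unique-⊆⇒length≤
    (Unique-map f (Uniq.filter⁺ (T? ∘ p) uniq) λ x∈ y∈ eq →
      trans (sym (inv x∈)) (trans (cong f eq) (inv y∈)))
    image)
  where
  member : ∀ {x} → x ∈ filterᵇ p xs → x ∈ xs × T (p x)
  member = ∈-filter⁻ (T? ∘ p)
  inv : ∀ {x} → x ∈ filterᵇ p xs → f (f x) ≡ x
  inv x∈ = let x∈xs , px = member x∈ in proj₂ (proj₂ (prop x∈xs px))
  image : ∀ {z} → z ∈ map f (filterᵇ p xs) → z ∈ filterᵇ q xs
  image z∈ with ∈-map⁻ f z∈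
  ... | x , x∈ , refl = let x∈xs , px = member x∈
                            fx∈ , qfx , _ = prop x∈xs px
                        in ∈-filter⁺ (T? ∘ q) fx∈ qfx

T-ext : ∀ {a b} → (T a → T b) → (T b → T a) → a ≡ b
T-ext {false} {false} _ _ = refl
T-ext {true}  {true}  _ _ = refl
T-ext {false} {true}  _ g = ⊥-elim (g tt)
T-ext {true}  {false} f _ = ⊥-elim (f tt)

T-not⇒¬T : ∀ {b} → T (not b) → ¬ T b
T-not⇒¬T {false} _ ()

¬T⇒T-not : ∀ {b} → ¬ T b → T (not b)
¬T⇒T-not {false} _ = tt
¬T⇒T-not {true}  f = f tt

filterᵇ-cong : ∀ {A : Set} {p q : A → Bool} (xs : List A) → (∀ {x} → x ∈ xs → p x ≡ q x) → filterᵇ p xs ≡ filterᵇ q xs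
filterᵇ-cong []       e = refl
filterᵇ-cong {p = p} {q} (x ∷ xs) e with p x | q x | e (here refl)
... | true  | .true  | refl = cong (x ∷_) (filterᵇ-cong xs (e ∘ there))
... | false | .false | refl = filterᵇ-cong xs (e ∘ there)

-- Sublists

sublists-⊆ : ∀ {A : Set} {S} (xs : List A) → S ∈ sublists xs → ∀ {z} → z ∈ S → z ∈ xs
sublists-⊆ []       (here refl) ()
sublists-⊆ (x ∷ xs) S∈ z∈ with ∈-++⁻ (map (x ∷_) (sublists xs)) S∈
... | inj₂ q = there (sublists-⊆ xs q z∈)
... | inj₁ q with ∈-map⁻ (x ∷_) q
sublists-⊆ (x ∷ xs) S∈ (here e)   | inj₁ q | S′ , S′∈ , refl = here e
sublists-⊆ (x ∷ xs) S∈ (there z∈) | inj₁ q | S′ , S′∈ , refl = there (sublists-⊆ xs S′∈ z∈)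

sublists-Unique : ∀ {A : Set} {xs : List A} → Unique xs → Unique (sublists xs)
sublists-Unique []                        = [] ∷ []
sublists-Unique {xs = x ∷ xs} (x∉ ∷ uniq) =
  Uniq.++⁺ (Uniq.map⁺ ∷-injectiveʳ (sublists-Unique uniq)) (sublists-Unique uniq) disjoint
  where
  disjoint : ∀ {S} → S ∈ map (x ∷_) (sublists xs) × S ∈ sublists xs → ⊥
  disjoint (p , q) with ∈-map⁻ (x ∷_) p
  ... | _ , _ , refl = All.lookup x∉ (sublists-⊆ xs q (here refl)) refl

filterᵇ∈sublists : ∀ {A : Set} (p : A → Bool) xs → filterᵇ p xs ∈ sublists xs
filterᵇ∈sublists p []       = here refl
filterᵇ∈sublists p (x ∷ xs) with p x
... | true  = ∈-++⁺ˡ (∈-map⁺ (x ∷_) (filterᵇ∈sublists p xs))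
... | false = ∈-++⁺ʳ (map (x ∷_) (sublists xs)) (filterᵇ∈sublists p xs)

cellEq⇒≡ : ∀ a b → T (cellEq a b) → a ≡ b
cellEq⇒≡ a b t = let p , q = Equivalence.to T-∧ t in cong₂ _,_ (≡ᵇ⇒≡ _ _ p) (≡ᵇ⇒≡ _ _ q)

≡⇒cellEq : ∀ a b → a ≡ b → T (cellEq a b)
≡⇒cellEq a .a refl = Equivalence.from T-∧ (≡⇒≡ᵇ (col a) _ refl , ≡⇒≡ᵇ (row a) _ refl)

elem⇒∈ : ∀ {a} S → T (elem a S) → a ∈ S
elem⇒∈ {a} S t = Any.map (λ {b} → cellEq⇒≡ a b) (any⁻ (cellEq a) S t)

∈⇒elem : ∀ {a S} → a ∈ S → T (elem a S)
∈⇒elem {a} a∈ = any⁺ (cellEq a) (Any.map (λ {b} → ≡⇒cellEq a b) a∈)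

-- Members of `sublists` keep the ambient order, so membership determines them; equal grids
-- therefore give equal lists.
sublist-filter : ∀ {S} {xs : List Cell} → Unique xs → S ∈ sublists xs → filterᵇ (λ c → elem c S) xs ≡ S
sublist-filter {xs = []}     _           (here refl) = refl
sublist-filter {S} {x ∷ xs} (x∉ ∷ uniq) S∈ with ∈-++⁻ (map (x ∷_) (sublists xs)) S∈
... | inj₂ q with elem x S in eq
...   | false = sublist-filter uniq q
...   | true  = ⊥-elim (All.lookup x∉ (sublists-⊆ xs q (elem⇒∈ S (Equivalence.from T-≡ eq))) refl)
sublist-filter {S} {x ∷ xs} (x∉ ∷ uniq) S∈ | inj₁ q with ∈-map⁻ (x ∷_) q
... | S′ , S′∈ , refl with elem x S in eq
...   | false = ⊥-elim (subst T eq (∈⇒elem {x} {S} (here refl)))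
...   | true  = cong (x ∷_) (trans (filterᵇ-cong xs same) (sublist-filter uniq S′∈))
  where
  same : ∀ {c} → c ∈ xs → elem c (x ∷ S′) ≡ elem c S′
  same {c} c∈ = T-ext (λ t → strip (elem⇒∈ {c} (x ∷ S′) t)) (λ t → ∈⇒elem (there (elem⇒∈ {c} S′ t)))
    where
    strip : c ∈ x ∷ S′ → T (elem c S′)
    strip (here refl) = ⊥-elim (All.lookup x∉ c∈ refl)
    strip (there p)   = ∈⇒elem p

-- The cells of a shape

∈-cellsFrom⁺ : ∀ j h x {y} → y < heightOf h (suc x) → (j + x , suc y) ∈ cellsFrom j h
∈-cellsFrom⁺ j (a ∷ h) zero    {y} p =
  ∈-++⁺ˡ (subst (λ z → (z , suc y) ∈ map (λ i → (j , suc i)) (upTo a)) (sym (+-identityʳ j))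
                (∈-map⁺ (λ i → (j , suc i)) (∈-upTo⁺ p)))
∈-cellsFrom⁺ j (a ∷ h) (suc x) {y} p =
  ∈-++⁺ʳ (map (λ i → (j , suc i)) (upTo a))
         (subst (λ z → (z , suc y) ∈ cellsFrom (suc j) h) (sym (+-suc j x)) (∈-cellsFrom⁺ (suc j) h x p))

∈-cellsFrom⁻ : ∀ j h {c} → c ∈ cellsFrom j h → ∃₂ λ x y → c ≡ (j + x , suc y) × y < heightOf h (suc x)
∈-cellsFrom⁻ j (a ∷ h) c∈ with ∈-++⁻ (map (λ i → (j , suc i)) (upTo a)) c∈
... | inj₁ p with ∈-map⁻ (λ i → (j , suc i)) p
...   | y , y∈ , refl = 0 , y , cong (_, suc y) (sym (+-identityʳ j)) , ∈-upTo⁻ y∈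
∈-cellsFrom⁻ j (a ∷ h) c∈ | inj₂ p with ∈-cellsFrom⁻ (suc j) h p
... | x , y , refl , lt = suc x , y , cong (_, suc y) (sym (+-suc j x)) , lt

cellsFrom-Unique : ∀ j h → Unique (cellsFrom j h)
cellsFrom-Unique j []      = []
cellsFrom-Unique j (a ∷ h) =
  Uniq.++⁺ (Uniq.map⁺ (suc-injective ∘ cong proj₂) (Uniq.upTo⁺ a)) (cellsFrom-Unique (suc j) h) disjoint
  where
  disjoint : ∀ {c} → c ∈ map (λ i → (j , suc i)) (upTo a) × c ∈ cellsFrom (suc j) h → ⊥
  disjoint (p , q) with ∈-map⁻ (λ i → (j , suc i)) p | ∈-cellsFrom⁻ (suc j) h q
  ... | y , _ , refl | x , _ , eq , _ = m≢1+m+n j (cong proj₁ eq)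

bit : Bool → ℕ
bit b = if b then 1 else 0

length-filterᵇ-column : ∀ (p : Cell → Bool) j n →
  length (filterᵇ p (map (λ i → (j , suc i)) (upTo n))) ≡ ∑ n (λ y → bit (p (j , suc y)))
length-filterᵇ-column p j zero    = refl
length-filterᵇ-column p j (suc n) = begin
  length (filterᵇ p (map f (upTo (suc n))))                             ≡⟨ cong (length ∘ filterᵇ p ∘ map f) (sym (upTo-∷ʳ n)) ⟩
  length (filterᵇ p (map f (upTo n ++ [ n ])))                          ≡⟨ cong (length ∘ filterᵇ p) (map-++ f (upTo n) [ n ]) ⟩
  length (filterᵇ p (map f (upTo n) ++ [ f n ]))                        ≡⟨ cong length (filter-++ (T? ∘ p) (map f (upTo n)) [ f n ]) ⟩
  length (filterᵇ p (map f (upTo n)) ++ filterᵇ p [ f n ])              ≡⟨ length-++ (filterᵇ p (map f (upTo n))) ⟩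
  length (filterᵇ p (map f (upTo n))) + length (filterᵇ p [ f n ])      ≡⟨ cong₂ _+_ (length-filterᵇ-column p j n) single ⟩
  ∑ n (λ y → bit (p (j , suc y))) + bit (p (j , suc n))                 ∎
  where
  open ≡-Reasoning
  f = λ i → (j , suc i)
  single : length (filterᵇ p [ f n ]) ≡ bit (p (f n))
  single with p (f n)
  ... | true  = refl
  ... | false = refl

length-filterᵇ-cells : ∀ (p q : Cell → Bool) j h →
  (∀ x → ∑ (heightOf h (suc x)) (λ y → bit (p (j + x , suc y))) ≡ ∑ (heightOf h (suc x)) (λ y → bit (q (j + x , suc y)))) →
  length (filterᵇ p (cellsFrom j h)) ≡ length (filterᵇ q (cellsFrom j h))
length-filterᵇ-cells p q j []      e = refl
length-filterᵇ-cells p q j (a ∷ h) e = begin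
  length (filterᵇ p (c ++ d))                         ≡⟨ split p ⟩
  length (filterᵇ p c) + length (filterᵇ p d)         ≡⟨ cong₂ _+_ column (length-filterᵇ-cells p q (suc j) h rest) ⟩
  length (filterᵇ q c) + length (filterᵇ q d)         ≡⟨ sym (split q) ⟩
  length (filterᵇ q (c ++ d))                         ∎
  where
  open ≡-Reasoning
  c = map (λ i → (j , suc i)) (upTo a)
  d = cellsFrom (suc j) h
  split : ∀ p → length (filterᵇ p (c ++ d)) ≡ length (filterᵇ p c) + length (filterᵇ p d)
  split p = trans (cong length (filter-++ (T? ∘ p) c d)) (length-++ (filterᵇ p c))
  column : length (filterᵇ p c) ≡ length (filterᵇ q c)
  column = trans (length-filterᵇ-column p j a)
    (trans (subst (λ z → ∑ a (λ y → bit (p (z , suc y))) ≡ ∑ a (λ y → bit (q (z , suc y)))) (+-identityʳ j) (e 0))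
           (sym (length-filterᵇ-column q j a)))
  rest : ∀ x → ∑ (heightOf h (suc x)) (λ y → bit (p (suc j + x , suc y))) ≡ ∑ (heightOf h (suc x)) (λ y → bit (q (suc j + x , suc y)))
  rest x = subst (λ z → ∑ (heightOf h (suc x)) (λ y → bit (p (z , suc y))) ≡ ∑ (heightOf h (suc x)) (λ y → bit (q (z , suc y))))
                 (+-suc j x) (e (suc x))

heightOf-dec : ∀ {h} → Linked (λ a b → b ≤ a) h → ∀ x → heightOf h (suc (suc x)) ≤ heightOf h (suc x)
heightOf-dec []       x       = z≤n
heightOf-dec [-]      x       = z≤n
heightOf-dec (p ∷ l)  zero    = p
heightOf-dec (p ∷ l)  (suc x) = heightOf-dec l x

-- Chains as lists

seqs⇒ : ∀ k S {c} → c ∈ seqs k S → length c ≡ k × All (_∈ S) c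
seqs⇒ zero    S (here refl) = refl , []
seqs⇒ (suc k) S c∈ with find (∈-concatMap⁻ (λ a → map (a ∷_) (seqs k S)) {xs = S} c∈)
... | a , a∈ , q with ∈-map⁻ (a ∷_) q
... | c′ , c′∈ , refl = let l , all∈ = seqs⇒ k S c′∈ in cong suc l , a∈ ∷ all∈

seqs⇐ : ∀ {S c} → All (_∈ S) c → c ∈ seqs (length c) S
seqs⇐ []                   = here refl
seqs⇐ {S} {a ∷ c} (a∈ ∷ p) = ∈-concatMap⁺ (λ a → map (a ∷_) (seqs (length c) S)) (lose a∈ (∈-map⁺ (a ∷_) (seqs⇐ p)))

Chain : (List Cell → Bool) → ℕ → List Cell → Set
Chain P k S = ∃ λ c → length c ≡ k × All (_∈ S) c × T (P c)

hasChain⇒ : ∀ P k S → T (hasChain P k S) → Chain P k S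
hasChain⇒ P k S t with find (any⁻ P (seqs k S) t)
... | c , c∈ , Pc = let l , p = seqs⇒ k S c∈ in c , l , p , Pc

hasChain⇐ : ∀ P k S → Chain P k S → T (hasChain P k S)
hasChain⇐ P .(length c) S (c , refl , p , Pc) = any⁺ P (lose (seqs⇐ p) Pc)

consec-tail : ∀ R a c → T (consec R (a ∷ c)) → T (consec R c)
consec-tail R a []      t = tt
consec-tail R a (b ∷ c) t = proj₂ (Equivalence.to (T-∧ {R a b}) t)

-- The lengths enter because the search range of `longest` depends on the list.
longest-cong : ∀ P Q S S′ → length S ≡ length S′ → (∀ k → hasChain P k S ≡ hasChain Q k S′) → longest P S ≡ longest Q S′
longest-cong P Q S S′ l e rewrite l =
  cong (foldr _⊔_ 0) (map-cong (λ k → cong (λ b → if b then k else 0) (e k)) (upTo (suc (length S′))))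

lastOr-All : ∀ {P : Cell → Set} {a c} → All P (a ∷ c) → P (lastOr a c)
lastOr-All {c = []}    (p ∷ _)  = p
lastOr-All {c = b ∷ c} (_ ∷ ps) = lastOr-All ps

∈-range⁻ : ∀ {lo hi i} → lo ≤ hi → i ∈ range lo hi → lo ≤ i × i ≤ hi
∈-range⁻ {lo} {hi} lo≤hi i∈ with ∈-map⁻ (lo +_) i∈
... | k , k∈ , refl = m≤m+n lo k ,
  ≤-trans (+-monoʳ-≤ lo (s≤s⁻¹ (∈-upTo⁻ k∈))) (≤-reflexive (m+[n∸m]≡n lo≤hi))

hi∈range : ∀ {lo hi} → lo ≤ hi → hi ∈ range lo hi
hi∈range {lo} {hi} lo≤hi = subst (_∈ range lo hi) (m+[n∸m]≡n lo≤hi) (∈-map⁺ (lo +_) (∈-upTo⁺ (n<1+n (hi ∸ lo))))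

⊓≤⊔ : ∀ m n → m ⊓ n ≤ m ⊔ n
⊓≤⊔ m n = ≤-trans (m⊓n≤m m n) (m≤m⊔n m n)

rectIn⇒ : ∀ h a b → T (rectIn h a b) → T (inF h (col a ⊔ col b , row a ⊔ row b))
rectIn⇒ h a b t = All.lookup (all⁺ _ _ (All.lookup (all⁺ _ _ t) (hi∈range (⊓≤⊔ (col a) (col b)))))
                             (hi∈range (⊓≤⊔ (row a) (row b)))

rectIn⇐ : ∀ h a b → (∀ j i → col a ⊓ col b ≤ j → j ≤ col a ⊔ col b → row a ⊓ row b ≤ i → i ≤ row a ⊔ row b → T (inF h (j , i))) →
  T (rectIn h a b)
rectIn⇐ h a b f = all⁻ _ (All.tabulate λ j∈ → all⁻ _ (All.tabulate λ i∈ →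
  let p , q = ∈-range⁻ (⊓≤⊔ (col a) (col b)) j∈
      r , s = ∈-range⁻ (⊓≤⊔ (row a) (row b)) i∈
  in f _ _ p q r s))

-- Translation between cell lists and grids

grid : List Cell → Grid
grid S x y = bit (elem (suc x , suc y) S)

bit-pos : ∀ {b} → 0 < bit b → T b
bit-pos {true} _ = tt

pos-bit : ∀ {b} → T b → 0 < bit b
pos-bit {true} _ = z<s

bit≤1 : ∀ b → bit b ≤ 1
bit≤1 true  = ≤-refl
bit≤1 false = z≤n

grid-pos⇒∈ : ∀ S {x y} → 0 < grid S x y → (suc x , suc y) ∈ S
grid-pos⇒∈ S p = elem⇒∈ S (bit-pos p)

∈⇒grid-pos : ∀ {S x y} → (suc x , suc y) ∈ S → 0 < grid S x y
∈⇒grid-pos p = pos-bit (∈⇒elem p)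

∑-unique≤1 : ∀ n {g} → (∀ i → g i ≤ 1) → (∀ i j → 0 < g i → 0 < g j → i ≡ j) → ∑ n g ≤ 1
∑-unique≤1 zero    b u = z≤n
∑-unique≤1 (suc n) {g} b u with g n in eq
... | zero  = ≤-trans (≤-reflexive (+-identityʳ _)) (∑-unique≤1 n b u)
... | suc k with ∑ n g in e
...   | zero  = subst (_≤ 1) eq (b n)
...   | suc _ = let i , i<n , p = ∑-positive g {n} (subst (0 <_) (sym e) z<s)
                in ⊥-elim (<-irrefl (u i n p (subst (0 <_) (sym eq) z<s)) i<n)

-- Cells are 1-indexed and grids 0-indexed, so a cell with a zero coordinate has no counterpart in
-- `grid`.
Positive : Cell → Set
Positive c = 0 < col c × 0 < row c

module _ (S : List Cell) where

  NE⇒list : ∀ {X Y x y k} → NE (grid S) X Y x y k →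
    ∃ λ c → length c ≡ k × All (_∈ S) c × (∀ a → col a ≤ x → row a ≤ y → T (consec neStep (a ∷ c)))
  NE⇒list (nil _ _) = [] , refl , [] , λ _ _ _ → tt
  NE⇒list (cons u v x≤u y≤v pos ch) =
    let c , l , p , r = NE⇒list ch
    in (suc u , suc v) ∷ c , cong suc l , grid-pos⇒∈ S pos ∷ p , λ a q q′ →
       Equivalence.from T-∧ ( Equivalence.from T-∧ (<⇒<ᵇ (s≤s (≤-trans q x≤u)) , <⇒<ᵇ (s≤s (≤-trans q′ y≤v)))
                            , r (suc u , suc v) ≤-refl ≤-refl)

  list⇒NE : ∀ {x y} a cs → All (_∈ S) (a ∷ cs) → All Positive (a ∷ cs) → T (consec neStep (a ∷ cs)) → x < col a → y < row a →
    NE (grid S) (col (lastOr a cs)) (row (lastOr a cs)) x y (suc (length cs))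
  list⇒NE (suc u , suc v) []       (a∈ ∷ []) _ _ p q = cons u v (s≤s⁻¹ p) (s≤s⁻¹ q) (∈⇒grid-pos a∈) (nil ≤-refl ≤-refl)
  list⇒NE (suc u , suc v) (b ∷ cs) (a∈ ∷ all∈) (_ ∷ all⁺) t p q =
    let s , t′ = Equivalence.to T-∧ t
        s₁ , s₂ = Equivalence.to T-∧ s
    in cons u v (s≤s⁻¹ p) (s≤s⁻¹ q) (∈⇒grid-pos a∈) (list⇒NE b cs all∈ all⁺ t′ (<ᵇ⇒< _ _ s₁) (<ᵇ⇒< _ _ s₂))

  SE⇒list : ∀ {X x y k} → SE (grid S) X x y k →
    ∃ λ c → length c ≡ k × All (_∈ S) c × All (λ a → col a ≤ X × row a ≤ y) c
          × (∀ a → col a ≤ x → y < row a → T (consec seStep (a ∷ c)))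
  SE⇒list (nil _) = [] , refl , [] , [] , λ _ _ _ → tt
  SE⇒list (cons u v x≤u v<y pos ch) =
    let c , l , p , b , r = SE⇒list ch
    in (suc u , suc v) ∷ c , cong suc l , grid-pos⇒∈ S pos ∷ p
     , (SE-bound ch , v<y) ∷ All.map (λ (m , n) → m , ≤-trans n (<⇒≤ v<y)) b , λ a q q′ →
       Equivalence.from T-∧ ( Equivalence.from T-∧ (<⇒<ᵇ (s≤s (≤-trans q x≤u)) , <⇒<ᵇ (≤-<-trans v<y q′))
                            , r (suc u , suc v) ≤-refl ≤-refl)

  list⇒SE : ∀ {x y} a cs → All (_∈ S) (a ∷ cs) → All Positive (a ∷ cs) → T (consec seStep (a ∷ cs)) → x < col a → row a ≤ y →
    SE (grid S) (col (lastOr a cs)) x y (suc (length cs))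
  list⇒SE (suc u , zero) _ _ ((_ , ()) ∷ _)
  list⇒SE (suc u , suc v) []       (a∈ ∷ []) _ _ p q = cons u v (s≤s⁻¹ p) q (∈⇒grid-pos a∈) (nil ≤-refl)
  list⇒SE (suc u , suc v) (b ∷ cs) (a∈ ∷ all∈) (_ ∷ all⁺) t p q =
    let s , t′ = Equivalence.to T-∧ t
        s₁ , s₂ = Equivalence.to T-∧ s
    in cons u v (s≤s⁻¹ p) q (∈⇒grid-pos a∈) (list⇒SE b cs all∈ all⁺ t′ (<ᵇ⇒< _ _ s₁) (s≤s⁻¹ (<ᵇ⇒< _ _ s₂)))

-- Fillings as lists of cells

module Shape (h : List ℕ) (ferrers : IsFerrers h) (sym-h : SymmetricShape h) where

  H : ℕ → ℕ
  H x = heightOf h (suc x)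

  H-anti : ∀ {x x′} → x ≤ x′ → H x′ ≤ H x
  H-anti {x} p = go (≤⇒≤′ p)
    where
    go : ∀ {x′} → x ≤′ x′ → H x′ ≤ H x
    go ≤′-refl     = ≤-refl
    go (≤′-step q) = ≤-trans (heightOf-dec (proj₁ ferrers) _) (go q)

  -- The first column is the highest, so `suc (H 0)` exceeds every height, and by symmetry it bounds
  -- the columns too.
  open Ferrers (suc (H 0)) H (heightOf-dec (proj₁ ferrers)) (λ x → s≤s (H-anti z≤n))
    (λ x y p → <ᵇ⇒< x (H y) (proj₁ (sym-h (suc x) (suc y)) (<⇒<ᵇ p)))

  ∈-cells⁺ : ∀ {x y} → F x y → (suc x , suc y) ∈ cells h
  ∈-cells⁺ {x} = ∈-cellsFrom⁺ 1 h x

  ∈-cells⁻ : ∀ {c} → c ∈ cells h → ∃₂ λ x y → c ≡ (suc x , suc y) × F x y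
  ∈-cells⁻ = ∈-cellsFrom⁻ 1 h

  Inside : List Cell → Set
  Inside S = ∀ {c} → c ∈ S → c ∈ cells h

  Inside-F : ∀ {S x y} → Inside S → (suc x , suc y) ∈ S → F x y
  Inside-F inside c∈ with ∈-cells⁻ (inside c∈)
  ... | _ , _ , refl , f = f

  Inside-Positive : ∀ {S c} → Inside S → c ∈ S → Positive c
  Inside-Positive inside c∈ with ∈-cells⁻ (inside c∈)
  ... | _ , _ , refl , _ = z<s , z<s

  hasChain-NE⇒ : ∀ {S} → Inside S → ∀ k → T (hasChain isNEchain (suc k) S) → HasNE (grid S) k
  hasChain-NE⇒ {S} inside k t with hasChain⇒ isNEchain (suc k) S t
  ... | a ∷ cs , refl , all∈ , ch with lastOr a cs | lastOr-All all∈
                                     | list⇒NE S {0} {0} a cs all∈ (All.map (Inside-Positive inside) all∈) ch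
                                         (proj₁ (Inside-Positive inside (All.head all∈)))
                                         (proj₂ (Inside-Positive inside (All.head all∈)))
  ... | b | b∈ | c with ∈-cells⁻ (inside b∈)
  ... | x , y , refl , f = x , ≤-<-trans z≤n f , NE-map (λ _ _ p → p) f c

  hasChain-NE⇐ : ∀ S k → HasNE (grid S) k → T (hasChain isNEchain (suc k) S)
  hasChain-NE⇐ S k (x , pos , ch) =
    let c , l , all∈ , r = NE⇒list S ch
    -- `(0 , 0)` is a virtual predecessor of the chain, removed by `consec-tail`.
    in hasChain⇐ isNEchain (suc k) S (c , l , all∈ , consec-tail neStep (0 , 0) c (r (0 , 0) z≤n z≤n))

  -- The upper right corner of the enclosing rectangle joins the last column to the first row, so
  -- its membership in `F` bounds the first row by the height of the last column.
  hasChain-SE⇒ : ∀ {S} → Inside S → ∀ k → T (hasChain (isSEchainInF h) (suc k) S) → HasSE (grid S) k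
  hasChain-SE⇒ {S} inside k t with hasChain⇒ (isSEchainInF h) (suc k) S t
  ... | a ∷ cs , refl , all∈ , ch with Equivalence.to (T-∧ {consec seStep (a ∷ cs)}) ch
  ... | ch₁ , ch₂ = go (∈-cells⁻ (inside (All.head all∈)))
    where
    b = lastOr a cs
    go : (∃₂ λ x y → a ≡ (suc x , suc y) × F x y) → HasSE (grid S) (length cs)
    go (x , y , refl , _) = build (suc x ⊔ col b) (m≤m⊔n (suc x) (col b)) (m≤n⊔m (suc x) (col b))
                                  (≤-trans (m≤m⊔n _ (row b)) (≤ᵇ⇒≤ _ _ (proj₂ (Equivalence.to T-∧ (rectIn⇒ h a b ch₂)))))
      where
      build : ∀ X → suc x ≤ X → col b ≤ X → suc y ≤ heightOf h X → HasSE (grid S) (length cs)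
      build (suc X) _ q r = X , ≤-<-trans z≤n r , SE-map (λ _ _ p → p) q
        (list⇒SE S a cs all∈ (All.map (Inside-Positive inside) all∈) ch₁ z<s r)

  hasChain-SE⇐ : ∀ {S} → Inside S → ∀ k → HasSE (grid S) k → T (hasChain (isSEchainInF h) (suc k) S)
  hasChain-SE⇐ {S} inside k (x , pos , ch) with SE⇒list S ch
  ... | c , l , all∈ , bounds , r =
    hasChain⇐ (isSEchainInF h) (suc k) S (c , l , all∈ , Equivalence.from T-∧
      -- The virtual predecessor lies left of and just above the rectangle.
      (consec-tail seStep (0 , suc (H x)) c (r (0 , suc (H x)) z≤n ≤-refl) , rect c all∈ bounds))
    where
    rect : ∀ c → All (_∈ S) c → All (λ a → col a ≤ suc x × row a ≤ H x) c → T (rectOK h c)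
    rect []       _    _      = tt
    rect (a ∷ cs) all∈ bounds = rectIn⇐ h a b λ j i p q r s →
      inside-rect j i (≤-trans (⊓-glb (proj₁ pa) (proj₁ pb)) p) (≤-trans q (⊔-lub (proj₁ ba) (proj₁ bb)))
                      (≤-trans (⊓-glb (proj₂ pa) (proj₂ pb)) r) (≤-trans s (⊔-lub (proj₂ ba) (proj₂ bb)))
      where
      b = lastOr a cs
      pa = Inside-Positive inside (All.head all∈)
      pb = Inside-Positive inside (lastOr-All all∈)
      ba = All.head bounds
      bb = lastOr-All bounds
      inside-rect : ∀ j i → 0 < j → j ≤ suc x → 0 < i → i ≤ H x → T (inF h (j , i))
      inside-rect (suc j) i _ j≤x 0<i i≤H =
        Equivalence.from T-∧ (≤⇒≤ᵇ 0<i , ≤⇒≤ᵇ (≤-trans i≤H (H-anti (s≤s⁻¹ j≤x))))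

  list⇒Filling : ∀ {S} → Inside S → T (atMostOnePerLine S) → T (symmetricFilling S) → Filling (grid S)
  list⇒Filling {S} inside one sm = record
    { pp = record
      { row≤1 = λ x y → ∑-unique≤1 x (λ j → bit≤1 (elem (suc j , suc y) S)) λ i j p q →
                  suc-injective (cong col (line (grid-pos⇒∈ S p) (grid-pos⇒∈ S q) (inj₂ refl)))
      ; col≤1 = λ x y → ∑-unique≤1 y (λ i → bit≤1 (elem (suc x , suc i) S)) λ i j p q →
                  suc-injective (cong row (line (grid-pos⇒∈ S p) (grid-pos⇒∈ S q) (inj₁ refl)))
      }
    ; symmetric = λ x y → cong bit (T-ext (transposed {suc x , suc y}) (transposed {suc y , suc x}))
    ; support   = λ x y ¬f → n<1⇒n≡0 (≰⇒> λ p → ¬f (Inside-F inside (grid-pos⇒∈ S p)))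
    }
    where
    line : ∀ {a b} → a ∈ S → b ∈ S → col a ≡ col b ⊎ row a ≡ row b → a ≡ b
    line {a} {b} a∈ b∈ e with Equivalence.to (T-∨ {cellEq a b}) (All.lookup (all⁺ _ S (All.lookup (all⁺ _ S one) a∈)) b∈)
    ... | inj₁ t = cellEq⇒≡ a b t
    ... | inj₂ t with Equivalence.to (T-∧ {not (col a ≡ᵇ col b)}) t
    line {a} {b} a∈ b∈ (inj₁ e) | inj₂ t | t₁ , _ = ⊥-elim (T-not⇒¬T t₁ (≡⇒≡ᵇ (col a) (col b) e))
    line {a} {b} a∈ b∈ (inj₂ e) | inj₂ t | _ , t₂ = ⊥-elim (T-not⇒¬T t₂ (≡⇒≡ᵇ (row a) (row b) e))
    transposed : ∀ {a} → T (elem a S) → T (elem (swap a) S)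
    transposed {a} t = All.lookup (all⁺ _ S sm) (elem⇒∈ {a} S t)

  module _ {S : List Cell} (inside : Inside S) (fil : Filling (grid S)) where
    open Filling fil

    Filling⇒atMostOnePerLine : T (atMostOnePerLine S)
    Filling⇒atMostOnePerLine = all⁻ _ (All.tabulate λ a∈ → all⁻ _ (All.tabulate λ b∈ → pair a∈ b∈))
      where
      pair : ∀ {a b} → a ∈ S → b ∈ S → T (cellEq a b ∨ (not (col a ≡ᵇ col b) ∧ not (row a ≡ᵇ row b)))
      pair {a} {b} a∈ b∈ with ∈-cells⁻ (inside a∈) | ∈-cells⁻ (inside b∈)
      ... | x , y , refl , _ | x′ , y′ , refl , _ with x ≟ x′ | y ≟ y′
      ... | yes refl | yes refl = Equivalence.from T-∨ (inj₁ (≡⇒cellEq a b refl))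
      ... | yes refl | no y≢y′  = ⊥-elim (y≢y′ (col-unique pp (∈⇒grid-pos a∈) (∈⇒grid-pos b∈)))
      ... | no x≢x′  | yes refl = ⊥-elim (x≢x′ (row-unique pp (∈⇒grid-pos a∈) (∈⇒grid-pos b∈)))
      ... | no x≢x′  | no y≢y′  = Equivalence.from (T-∨ {cellEq a b}) (inj₂ (Equivalence.from T-∧
        (¬T⇒T-not (x≢x′ ∘ ≡ᵇ⇒≡ x x′) , ¬T⇒T-not (y≢y′ ∘ ≡ᵇ⇒≡ y y′))))

    Filling⇒symmetricFilling : T (symmetricFilling S)
    Filling⇒symmetricFilling = all⁻ _ (All.tabulate go)
      where
      go : ∀ {a} → a ∈ S → T (elem (swap a) S)
      go a∈ with ∈-cells⁻ (inside a∈)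
      ... | x , y , refl , _ = bit-pos (subst (0 <_) (symmetric x y) (∈⇒grid-pos a∈))

  positive : Grid → Cell → Bool
  positive B (suc x , suc y) = 0 <ᵇ B x y
  positive B _               = false

  toList : Grid → List Cell
  toList B = filterᵇ (positive B) (cells h)

  grid-toList : ∀ {B} → Filling B → ∀ x y → grid (toList B) x y ≡ B x y
  grid-toList {B} fil x y with B x y in eq
  ... | zero = n<1⇒n≡0 (≰⇒> λ p → <⇒≱ (<ᵇ⇒< 0 (B x y) (proj₂ (∈-filter⁻ (T? ∘ positive B) {xs = cells h} (grid-pos⇒∈ (toList B) p))))
                                  (≤-reflexive eq))
  ... | suc k = ≤-antisym (≤-trans (bit≤1 (elem (suc x , suc y) (toList B))) z<s)
                  (≤-trans (subst (_≤ 1) eq (≤-trans (m≤n+m (B x y) _) (col≤1 pp x (suc y))))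
                           (∈⇒grid-pos (∈-filter⁺ (T? ∘ positive B) (∈-cells⁺ f) (<⇒<ᵇ pos))))
    where
    open Filling fil
    pos : 0 < B x y
    pos = subst (0 <_) (sym eq) z<s
    f : F x y
    f with y <? H x
    ... | yes f = f
    ... | no ¬f = ⊥-elim (<⇒≱ pos (≤-reflexive (support x y ¬f)))

  toList-Inside : ∀ B → Inside (toList B)
  toList-Inside B c∈ = proj₁ (∈-filter⁻ (T? ∘ positive B) {xs = cells h} c∈)

  toList-grid : ∀ {S B} → S ∈ sublists (cells h) → (∀ x y → B x y ≡ grid S x y) → toList B ≡ S
  toList-grid {S} {B} S∈ e = trans (filterᵇ-cong (cells h) same) (sublist-filter (cellsFrom-Unique 1 h) S∈)
    where
    same : ∀ {c} → c ∈ cells h → positive B c ≡ elem c S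
    same c∈ with ∈-cells⁻ c∈
    ... | x , y , refl , _ = T-ext (λ t → bit-pos (subst (0 <_) (e x y) (<ᵇ⇒< 0 _ t)))
                                   (λ t → <⇒<ᵇ (subst (0 <_) (sym (e x y)) (pos-bit t)))

  ΦL : List Cell → List Cell
  ΦL S = toList (Φ (grid S))

  module _ {S : List Cell} (S∈ : S ∈ sublists (cells h)) (fil : Filling (grid S)) where

    private
      inside : Inside S
      inside = sublists-⊆ (cells h) S∈
      B : Grid
      B = Φ (grid S)
      filB : Filling B
      filB = Φ-Filling fil
      e : ∀ x y → grid (ΦL S) x y ≡ B x y
      e = grid-toList filB
      inside′ : Inside (ΦL S)
      inside′ = toList-Inside B

    ΦL-Filling : Filling (grid (ΦL S))
    ΦL-Filling = Filling-cong (λ x y → sym (e x y)) filB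

    ΦL-involutive : ΦL (ΦL S) ≡ S
    ΦL-involutive = toList-grid S∈ (λ x y → trans (Φ-cong e x y) (Φ-involutive fil x y))

    ΦL-length : length (ΦL S) ≡ length S
    ΦL-length = trans (length-filterᵇ-cells (positive B) (λ c → elem c S) 1 h column)
                      (cong length (sublist-filter (cellsFrom-Unique 1 h) S∈))
      where
      bits : ∀ x y → bit (positive B (suc x , suc y)) ≡ B x y
      bits x y = ≤1 (≤-trans (m≤n+m (B x y) _) (col≤1 (Filling.pp filB) x (suc y)))
        where
        ≤1 : ∀ {n} → n ≤ 1 → bit (0 <ᵇ n) ≡ n
        ≤1 z≤n       = refl
        ≤1 (s≤s z≤n) = refl
      column : ∀ x → ∑ (H x) (λ y → bit (positive B (suc x , suc y))) ≡ ∑ (H x) (λ y → grid S x y)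
      column x with 0 <? H x
      ... | yes pos = trans (∑-cong (H x) λ y _ → bits x y) (Φ-col fil (F-boundˣ pos))
      ... | no ¬pos = ∑-cong (H x) λ y y<H → ⊥-elim (¬pos (≤-<-trans z≤n y<H))

    hasChain-NE-ΦL : ∀ k → hasChain isNEchain k (ΦL S) ≡ hasChain (isSEchainInF h) k S
    hasChain-NE-ΦL zero    = refl
    hasChain-NE-ΦL (suc k) = T-ext
      (λ t → hasChain-SE⇐ inside k (HasNE-Φ⇒HasSE fil k (HasNE-cong e (hasChain-NE⇒ inside′ k t))))
      (λ t → hasChain-NE⇐ (ΦL S) k (HasNE-cong (λ x y → sym (e x y)) (HasSE⇒HasNE-Φ fil k (hasChain-SE⇒ inside k t))))

    hasChain-SE-ΦL : ∀ k → hasChain (isSEchainInF h) k (ΦL S) ≡ hasChain isNEchain k S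
    hasChain-SE-ΦL zero    = refl
    hasChain-SE-ΦL (suc k) = T-ext
      (λ t → hasChain-NE⇐ S k (HasSE-Φ⇒HasNE fil k (HasSE-cong e (hasChain-SE⇒ inside′ k t))))
      (λ t → hasChain-SE⇐ inside′ k (HasSE-cong (λ x y → sym (e x y)) (HasNE⇒HasSE-Φ fil k (hasChain-NE⇒ inside k t))))

    longestNE-ΦL : longestNE (ΦL S) ≡ longestSE h S
    longestNE-ΦL = longest-cong isNEchain (isSEchainInF h) (ΦL S) S ΦL-length hasChain-NE-ΦL

    longestSE-ΦL : longestSE h (ΦL S) ≡ longestNE S
    longestSE-ΦL = longest-cong (isSEchainInF h) isNEchain (ΦL S) S ΦL-length hasChain-SE-ΦL

  ΦL-admissible : ∀ {n s t S} → S ∈ sublists (cells h) → T (admissible h n s t S) →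
    ΦL S ∈ sublists (cells h) × T (admissible h n t s (ΦL S)) × ΦL (ΦL S) ≡ S
  ΦL-admissible {n} {s} {t} {S} S∈ adm =
    let len , adm₁ = Equivalence.to T-∧ adm
        one , adm₂ = Equivalence.to (T-∧ {atMostOnePerLine S}) adm₁
        sm  , adm₃ = Equivalence.to (T-∧ {symmetricFilling S}) adm₂
        ne  , se   = Equivalence.to T-∧ adm₃
        fil        = list⇒Filling (sublists-⊆ (cells h) S∈) one sm
        inside′    = toList-Inside (Φ (grid S))
        fil′       = ΦL-Filling S∈ fil
    in filterᵇ∈sublists (positive (Φ (grid S))) (cells h)
     , Equivalence.from T-∧ (subst (λ l → T (l ≡ᵇ n)) (sym (ΦL-length S∈ fil)) len
     , Equivalence.from T-∧ (Filling⇒atMostOnePerLine inside′ fil′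
     , Equivalence.from T-∧ (Filling⇒symmetricFilling inside′ fil′
     , Equivalence.from T-∧ (subst (λ l → T (l ≡ᵇ t)) (sym (longestNE-ΦL S∈ fil)) se
                            , subst (λ l → T (l ≡ᵇ s)) (sym (longestSE-ΦL S∈ fil)) ne))))
     , ΦL-involutive S∈ fil

  Nsym-≤ : ∀ n s t → Nsym h n s t ≤ Nsym h n t s
  Nsym-≤ n s t = filterᵇ-involution (sublists-Unique (cellsFrom-Unique 1 h))
    (admissible h n s t) (admissible h n t s) ΦL (ΦL-admissible {n} {s} {t})

theorem14 : (h : List ℕ) → IsFerrers h → SymmetricShape h →
    (n s t : ℕ) → 1 ≤ s → 1 ≤ t →
    Nsym h n s t ≡ Nsym h n t s
theorem14 h ferrers sym-h n s t _ _ = ≤-antisym (Nsym-≤ n s t) (Nsym-≤ n t s)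
  where open Shape h ferrers sym-h
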